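{- Every extremal tree is either a tree of stars or a path with an odd number of edges.
   Context: All graphs are finite, simple, undirected. For a graph $G$, $F(G)$ denotes the number of stable (independent) sets of $G$, including the empty set, and $\alpha(G)$ is the stability number (maximum size of a stable set). A tree $T$ is extremal if $F(T)$ is minimum among all trees with $|V(T)|$ vertices and stability number $\alpha(T)$. A leaf of a tree is a vertex of degree at most $1$ (so the single vertex of a one-vertex tree is a leaf). Trees of stars are defined inductively: a single vertex is a tree of stars; if $T_1,\dots,T_k$ ($k\ge 2$) are disjoint trees of stars and $v_i$ is a leaf of $T_i$ for each $i$, then the tree obtained from $T_1\cup\dots\cup T_k$ by adding a new vertex $w$ adjacent to every $v_i$ is a tree of stars. -}

module Defs where

open import Data.Nat using (ℕ; zero; suc; _+_; _*_; _∸_; _≤_; _⊔_)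
open import Data.Bool using (Bool; true; false; _∧_; not)
open import Data.Fin using (Fin; zero; suc; toℕ; inject₁; fromℕ)
open import Data.Fin.Subset using (Subset; ∣_∣)
open import Data.Vec using (Vec; []; _∷_; lookup)
open import Data.List using (List; []; _∷_; _++_; map; length; filterᵇ; foldr; allFin)
open import Data.Maybe using (Maybe; just; nothing)
open import Data.Product using (Σ; _,_; _×_; ∃; ∃-syntax)
open import Data.Sum using (_⊎_)
open import Data.Unit using (⊤)
open import Data.Empty using (⊥)
open import Function.Definitions using (Injective)
open import Function.Bundles using (_⇔_)
open import Relation.Nullary using (¬_)
open import Relation.Binary.PropositionalEquality using (_≡_)

record SimpleGraph (n : ℕ) : Set where
  field
    adj    : Fin n → Fin n → Bool
    sym    : ∀ i j → adj i j ≡ adj j i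
    irrefl : ∀ i → adj i i ≡ false
open SimpleGraph public

Adj : ∀ {n} → SimpleGraph n → Fin n → Fin n → Set
Adj G i j = adj G i j ≡ true

allᵇ : {A : Set} → (A → Bool) → List A → Bool
allᵇ p []       = true
allᵇ p (x ∷ xs) = p x ∧ allᵇ p xs

allSubsets : (n : ℕ) → List (Subset n)
allSubsets zero    = [] ∷ []
allSubsets (suc n) = map (false ∷_) (allSubsets n) ++ map (true ∷_) (allSubsets n)

isStable : ∀ {n} → SimpleGraph n → Subset n → Bool
isStable {n} G s =
  allᵇ (λ i → allᵇ (λ j → not (lookup s i ∧ lookup s j ∧ adj G i j)) (allFin n)) (allFin n)

stableSets : ∀ {n} → SimpleGraph n → List (Subset n)
stableSets {n} G = filterᵇ (isStable G) (allSubsets n)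

F : ∀ {n} → SimpleGraph n → ℕ
F G = length (stableSets G)

α : ∀ {n} → SimpleGraph n → ℕ
α G = foldr _⊔_ 0 (map ∣_∣ (stableSets G))

data Reachable {n} (G : SimpleGraph n) : Fin n → Fin n → Set where
  here : ∀ {u} → Reachable G u u
  step : ∀ {u v w} → Adj G u v → Reachable G v w → Reachable G u w

Connected : ∀ {n} → SimpleGraph n → Set
Connected {n} G = ∀ (u v : Fin n) → Reachable G u v

record Cycle {n} (G : SimpleGraph n) : Set where
  field
    m      : ℕ
    c      : Fin (suc (suc (suc m))) → Fin n
    inj    : Injective _≡_ _≡_ c
    cons   : ∀ (i : Fin (suc (suc m))) → Adj G (c (inject₁ i)) (c (suc i))
    close  : Adj G (c (fromℕ (suc (suc m)))) (c zero)

Acyclic : ∀ {n} → SimpleGraph n → Set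
Acyclic G = ¬ Cycle G

IsTree : ∀ {n} → SimpleGraph n → Set
IsTree {n} G = (1 ≤ n) × Connected G × Acyclic G

Extremal : ∀ {n} → SimpleGraph n → Set
Extremal {n} G = IsTree G × (∀ (H : SimpleGraph n) → IsTree H → α H ≡ α G → F G ≤ F H)

record Graph (V : Set) : Set₁ where
  field
    Edge : V → V → Set
open Graph public

toGraph : ∀ {n} → SimpleGraph n → Graph (Fin n)
toGraph G = record { Edge = Adj G }

record _≅_ {V W : Set} (G : Graph V) (H : Graph W) : Set where
  field
    to      : V → W
    from    : W → V
    from∘to : ∀ x → from (to x) ≡ x
    to∘from : ∀ y → to (from y) ≡ y
    edge⇔   : ∀ x y → Edge G x y ⇔ Edge H (to x) (to y)

-- leaf: degree at most 1
IsLeaf : ∀ {V} → Graph V → V → Set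
IsLeaf {V} G v = ∀ (x y : V) → Edge G v x → Edge G v y → x ≡ y

singleGraph : Graph ⊤
singleGraph = record { Edge = λ _ _ → ⊥ }

-- vertex set of the join: nothing = new vertex w, just (i , x) = x ∈ T_i
module _ {k : ℕ} {V : Fin k → Set} (G : (i : Fin k) → Graph (V i)) (v : (i : Fin k) → V i) where
  data JoinEdge : Maybe (Σ (Fin k) V) → Maybe (Σ (Fin k) V) → Set where
    w→v    : ∀ i → JoinEdge nothing (just (i , v i))
    v→w    : ∀ i → JoinEdge (just (i , v i)) nothing
    inside : ∀ i {x y} → Edge (G i) x y → JoinEdge (just (i , x)) (just (i , y))

  joinGraph : Graph (Maybe (Σ (Fin k) V))
  joinGraph = record { Edge = JoinEdge }

data IsTreeOfStars : {V : Set} → Graph V → Set₁ where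
  single : IsTreeOfStars singleGraph
  join   : ∀ {k} → 2 ≤ k → {V : Fin k → Set} (G : (i : Fin k) → Graph (V i)) →
           (∀ i → IsTreeOfStars (G i)) →
           (v : (i : Fin k) → V i) → (∀ i → IsLeaf (G i) (v i)) →
           IsTreeOfStars (joinGraph G v)

TreeOfStars : ∀ {n} → SimpleGraph n → Set₁
TreeOfStars G = Σ Set λ V → Σ (Graph V) λ H → IsTreeOfStars H × (toGraph G ≅ H)

pathGraph : (n : ℕ) → Graph (Fin n)
pathGraph n = record { Edge = λ i j → (toℕ j ≡ suc (toℕ i)) ⊎ (toℕ i ≡ suc (toℕ j)) }

-- G is a path with an odd number of edges (a path on n vertices has n - 1 edges)
OddPath : ∀ {n} → SimpleGraph n → Set
OddPath {n} G = (toGraph G ≅ pathGraph n) × (∃[ k ] (n ∸ 1 ≡ suc (2 * k)))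

{-# OPTIONS --safe #-}
-- Root an extremal tree T at a leaf and try to label its vertices alternately A and B
-- so that all leaves are in B and all B-vertices have degree at most two; such a
-- labelling exhibits T as a tree of stars.  A lowest obstruction is a vertex v of
-- degree at least three having either an A-child and a B-child, or two A-children.
--
-- An edge between the roots of t and s contributes F(t) F(s) − f₁(t) f₁(s), where f₁
-- counts the stable sets containing the root, so F drops when a subtree is moved to a
-- vertex lying in more stable sets.
--   * A-child y and B-child z: some maximum stable set of y avoids its root, so y may be
--     moved anywhere without changing α.  It is moved to a leaf of z: without y, the ratio
--     (stable sets containing it) / (stable sets avoiding it) exceeds (√5 − 1)/2 there and
--     is smaller at v, unless z is a path, where the two vertices are compared directly.
--   * Two A-children, y₂ being the one whose root lies in the smaller fraction of stable
--     sets: let a be the neighbour of a leaf u of y₂.  If a lies in more stable sets of y₂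
--     than the root does, attach y₂ to v by a instead; otherwise moving the rest of T
--     from v to u is an improvement.
-- If instead the labelling puts only the root leaf on the wrong side, then T is a path
-- with an odd number of edges, or its first branching vertex is of the first kind.
module Submission where

open import Defs renaming (sym to adj-sym)
open import Data.Bool using (Bool; true; false; _∧_; not)
import Data.Bool.Properties as Bool
open import Data.Empty using (⊥; ⊥-elim)
open import Data.Fin using (Fin; zero; suc; toℕ; inject₁; fromℕ; splitAt; punchIn; punchOut; _≟_)
  renaming (join to joinᶠ)
open import Data.Fin.Properties using (any?; injective⇒≤; splitAt-join; join-splitAt;
    toℕ-inject₁; toℕ-injective; ∀-cons; punchIn-injective; punchInᵢ≢i; punchIn-punchOut;
    punchOut-punchIn; punchOut-cong)
  renaming (suc-injective to sucᶠ-injective)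
open import Data.Fin.Relation.Unary.Top using (view; ‵fromℕ; ‵inject₁)
open import Data.Fin.Subset using (Subset; ∣_∣)
open import Data.List using (List; []; _∷_; _++_; map; length; lookup; allFin; cartesianProduct; foldr)
open import Data.List.Membership.DecPropositional using () renaming (_∈?_ to mem?)
open import Data.List.Membership.Propositional using (_∈_)
open import Data.List.Membership.Propositional.Properties
open import Data.List.Properties using (length-++; length-map)
import Data.List.Relation.Unary.All as All
open import Data.List.Relation.Unary.AllPairs using ([]; _∷_)
import Data.List.Relation.Unary.Any as Any
open import Data.List.Relation.Unary.Any using (here; there)
open import Data.List.Relation.Unary.Any.Properties using (lookup-index)
open import Data.List.Relation.Unary.Linked using (Linked; [-]; _∷_)
open import Data.List.Relation.Unary.Unique.Propositional using (Unique)
import Data.List.Relation.Unary.Unique.Propositional.Properties as Unique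
import Data.Maybe as Maybe
open import Data.Maybe using (Maybe; just; nothing)
open import Data.Nat hiding (_≟_)
open import Data.Nat.Properties hiding (_≟_)
open import Data.Nat.Tactic.RingSolver using (solve-∀)
open import Data.Product using (Σ; _×_; _,_; proj₁; proj₂; ∃-syntax; Σ-syntax)
import Data.Sum as Sum
open import Data.Sum using (_⊎_; inj₁; inj₂)
open import Data.Sum.Properties using (inj₁-injective; inj₂-injective)
open import Data.Unit using (⊤; tt)
import Data.Vec as Vec
open import Data.Vec using ([]; _∷_)
import Data.Vec.Properties as Vec
import Function.Construct.Composition as Comp
open import Function using (_∘_; _⇔_; mk⇔; Equivalence)
open import Relation.Binary.PropositionalEquality
open import Relation.Nullary using (¬_; yes; no; ¬?)
open import Relation.Nullary.Decidable using (_×-dec_)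

-- Rooted trees and their stable-set invariants

-- t ◁ s hangs the rooted tree s from the root of t.  The subscripts 0 and 1 refer to
-- stable sets avoiding and containing the root.
infixl 6 _◁_

data Tree : Set where
  •   : Tree
  _◁_ : Tree → Tree → Tree

size f₀ f₁ ftot α₀ α₁ αtot : Tree → ℕ
size •       = 1
size (t ◁ s) = size t + size s
f₀ •       = 1
f₀ (t ◁ s) = f₀ t * ftot s
f₁ •       = 1
f₁ (t ◁ s) = f₁ t * f₀ s
ftot t = f₀ t + f₁ t
α₀ •       = 0
α₀ (t ◁ s) = α₀ t + αtot s
α₁ •       = 1
α₁ (t ◁ s) = α₁ t + α₀ s
αtot t = α₀ t ⊔ α₁ t

f₀>0 : ∀ t → 0 < f₀ t
f₁>0 : ∀ t → 0 < f₁ t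
f₀>0 •       = s≤s z≤n
f₀>0 (t ◁ s) = *-mono-< (f₀>0 t) (<-≤-trans (f₀>0 s) (m≤m+n _ _))
f₁>0 •       = s≤s z≤n
f₁>0 (t ◁ s) = *-mono-< (f₁>0 t) (f₀>0 s)

f₁≤f₀ : ∀ t → f₁ t ≤ f₀ t
f₁≤f₀ •       = ≤-refl
f₁≤f₀ (t ◁ s) = *-mono-≤ (f₁≤f₀ t) (m≤m+n _ _)

f₁<f₀ : ∀ t s → f₁ (t ◁ s) < f₀ (t ◁ s)
f₁<f₀ t s = ≤-<-trans (*-monoˡ-≤ (f₀ s) (f₁≤f₀ t))
  (*-monoʳ-< (f₀ t) {{>-nonZero (f₀>0 t)}} (m<m+n (f₀ s) (f₁>0 s)))

α₁≤1+α₀ : ∀ t → α₁ t ≤ suc (α₀ t)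
α₁≤1+α₀ •       = ≤-refl
α₁≤1+α₀ (t ◁ s) = +-mono-≤ (α₁≤1+α₀ t) (m≤m⊔n _ _)

-- Equality of invariants and change of root

infix 4 _≈ʳ_ _≈_

-- Compares invariants, not trees; these five determine the invariants of every tree obtained by
-- hanging further subtrees.
record _≈ʳ_ (t u : Tree) : Set where
  constructor mkʳ
  field
    size≡ : size t ≡ size u
    f₀≡   : f₀ t ≡ f₀ u
    f₁≡   : f₁ t ≡ f₁ u
    α₀≡   : α₀ t ≡ α₀ u
    α₁≡   : α₁ t ≡ α₁ u

-- What survives when the root is forgotten: exactly the data needed to compare trees for
-- extremality.
record _≈_ (t u : Tree) : Set where
  constructor mk≈
  field
    size≡ : size t ≡ size u
    α≡    : αtot t ≡ αtot u
    f≡    : ftot t ≡ ftot u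

≈ʳ⇒≈ : ∀ {t u} → t ≈ʳ u → t ≈ u
≈ʳ⇒≈ (mkʳ a b c d e) = mk≈ a (cong₂ _⊔_ d e) (cong₂ _+_ b c)

≈-refl : ∀ {t} → t ≈ t
≈-refl = mk≈ refl refl refl

≈-sym : ∀ {t u} → t ≈ u → u ≈ t
≈-sym (mk≈ a b c) = mk≈ (sym a) (sym b) (sym c)

≈-trans : ∀ {t u v} → t ≈ u → u ≈ v → t ≈ v
≈-trans (mk≈ a b c) (mk≈ a' b' c') = mk≈ (trans a a') (trans b b') (trans c c')

≈ʳ-trans : ∀ {t u v} → t ≈ʳ u → u ≈ʳ v → t ≈ʳ v
≈ʳ-trans (mkʳ a b c d e) (mkʳ a' b' c' d' e') =
  mkʳ (trans a a') (trans b b') (trans c c') (trans d d') (trans e e')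

◁-congˡ : ∀ {t u} s → t ≈ʳ u → t ◁ s ≈ʳ u ◁ s
◁-congˡ s (mkʳ a b c d e) = mkʳ (cong (_+ size s) a) (cong (_* ftot s) b) (cong (_* f₀ s) c)
  (cong (_+ αtot s) d) (cong (_+ α₀ s) e)

xy∙z≡xz∙y : ∀ x y z → x + y + z ≡ x + z + y
xy∙z≡xz∙y = solve-∀

◁-swap : ∀ t s u → (t ◁ s) ◁ u ≈ʳ (t ◁ u) ◁ s
◁-swap t s u = mkʳ (xy∙z≡xz∙y (size t) _ _) (mul (f₀ t) _ _) (mul (f₁ t) _ _)
  (xy∙z≡xz∙y (α₀ t) _ _) (xy∙z≡xz∙y (α₁ t) _ _)
  where
  mul : ∀ x y z → x * y * z ≡ x * z * y
  mul = solve-∀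

-- Lists the three ways in which a stable set can meet the two ends of the joining edge. This form
-- is symmetric in the two trees up to reordering.
α-edge : ∀ t s → αtot (t ◁ s) ≡ (α₀ t + α₀ s) ⊔ ((α₀ t + α₁ s) ⊔ (α₁ t + α₀ s))
α-edge t s = trans (cong (_⊔ (α₁ t + α₀ s)) (+-distribˡ-⊔ (α₀ t) (α₀ s) (α₁ s))) (⊔-assoc (α₀ t + α₀ s) _ _)

-- Both trees are the unrooted tree obtained by joining the two roots.
◁-comm : ∀ t s → t ◁ s ≈ s ◁ t
◁-comm t s = mk≈ (+-comm (size t) _) α-comm (F-comm (f₀ t) (f₁ t) (f₀ s) (f₁ s))
  where
  α-comm : αtot (t ◁ s) ≡ αtot (s ◁ t)
  α-comm = trans (α-edge t s) (trans
    (cong₂ _⊔_ (+-comm (α₀ t) _) (trans (⊔-comm (α₀ t + α₁ s) _)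
      (cong₂ _⊔_ (+-comm (α₁ t) _) (+-comm (α₀ t) _))))
    (sym (α-edge s t)))
  F-comm : ∀ a b c d → a * (c + d) + b * c ≡ c * (a + b) + d * a
  F-comm = solve-∀

-- The root moves along two edges, past an intermediate vertex of degree two: the step from one
-- centre to the next.
reroot : ∀ X q z → X ◁ (• ◁ (q ◁ z)) ≈ (q ◁ (• ◁ X)) ◁ z
reroot X q z =
  ≈-trans (◁-comm X _) (≈-trans (≈ʳ⇒≈ (◁-swap • (q ◁ z) X))
    (≈-trans (◁-comm (• ◁ X) (q ◁ z)) (≈ʳ⇒≈ (◁-swap q z (• ◁ X)))))

-- A competitor refuting the extremality of `t`; being stated through invariants alone, it transfers
-- along `≈`.
record Better (t : Tree) : Set where
  constructor better
  field
    tree   : Tree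
    size≡  : size tree ≡ size t
    α≡     : αtot tree ≡ αtot t
    f<     : ftot tree < ftot t

Better-resp : ∀ {t u} → t ≈ u → Better u → Better t
Better-resp (mk≈ a b c) (better w a' b' c') =
  better w (trans a' (sym a)) (trans b' (sym b)) (subst (ftot w <_) (sym c) c')

-- Ratios compared with the golden section

-- Ratios y / x below and above the golden section (√5 − 1) / 2.
Below Above : ℕ → ℕ → Set
Below y x = y * y + y * x < x * x
Above y x = x * x < y * y + y * x

-- Here r - l = q - p, so a new strict inequality follows from a known one by a polynomial identity.
shift-< : ∀ {l r p q} → p < q → l + q ≡ r + p → l < r
shift-< {l} {r} {p} {q} p<q eq = +-cancelʳ-< p l r
  (subst (l + p <_) eq (+-monoʳ-< l p<q))

Below-scale : ∀ {y x a b} → Below y x → a ≤ b → 0 < b → Below (y * a) (x * b)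
Below-scale {y} {x} {a} {b} lt a≤b b>0 = begin-strict
  y * a * (y * a) + y * a * (x * b)   ≤⟨ +-mono-≤ (*-mono-≤ ya≤yb ya≤yb) (*-monoˡ-≤ (x * b) ya≤yb) ⟩
  y * b * (y * b) + y * b * (x * b)   ≡⟨ e₁ y x b ⟩
  (b * b) * (y * y + y * x)           <⟨ *-monoʳ-< (b * b) {{>-nonZero (*-mono-< b>0 b>0)}} lt ⟩
  (b * b) * (x * x)                   ≡⟨ e₂ x b ⟩
  x * b * (x * b)                     ∎
  where
  open ≤-Reasoning
  ya≤yb = *-monoʳ-≤ y a≤b
  e₁ : ∀ y x b → y * b * (y * b) + y * b * (x * b) ≡ (b * b) * (y * y + y * x)
  e₁ = solve-∀
  e₂ : ∀ x b → (b * b) * (x * x) ≡ x * b * (x * b)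
  e₂ = solve-∀

Below-scale′ : ∀ {y x a b} → Below y x → a ≤ b → 0 < b → Below (a * y) (b * x)
Below-scale′ {y} {x} {a} {b} lt a≤b b>0 =
  subst₂ Below (*-comm y a) (*-comm x b) (Below-scale {y} {x} lt a≤b b>0)

-- Hanging `s` multiplies the ratio at the root by `f₀ s` / `ftot s`, which is less than one.
Below-◁ : ∀ t s → Below (f₁ t) (f₀ t) → Below (f₁ (t ◁ s)) (f₀ (t ◁ s))
Below-◁ t s lt = Below-scale {f₁ t} {f₀ t} {f₀ s} {ftot s} lt (m≤m+n _ _) (<-≤-trans (f₀>0 s) (m≤m+n _ _))

-- Otherwise y = y′ + d and x′ = d + x, and the sum of the two hypotheses contradicts a polynomial
-- identity with nonnegative slack.
Below-Above : ∀ {y x y′ x′} → y + x ≡ y′ + x′ → Below y x → Above y′ x′ → y < y′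
Below-Above {y} {x} {y′} {x′} eq lo hi with y <? y′
... | yes p = p
... | no ¬p with m≤n⇒∃[o]m+o≡n (≮⇒≥ ¬p)
...   | d , refl with +-cancelˡ-≡ y′ (d + x) x′ (trans (sym (+-assoc y′ d x)) eq)
...     | refl = ⊥-elim (<-irrefl refl (<-≤-trans (+-mono-< lo hi) (begin
  x * x + (y′ * y′ + y′ * (d + x))                        ≤⟨ m≤m+n _ _ ⟩
  x * x + (y′ * y′ + y′ * (d + x)) + (2 * (d * d) + 3 * (d * x) + y′ * d)  ≡⟨ e d x y′ ⟩
  (y′ + d) * (y′ + d) + (y′ + d) * x + (d + x) * (d + x)  ∎)))
  where
  open ≤-Reasoning
  e : ∀ d x y′ → x * x + (y′ * y′ + y′ * (d + x)) + (2 * (d * d) + 3 * (d * x) + y′ * d)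
                 ≡ (y′ + d) * (y′ + d) + (y′ + d) * x + (d + x) * (d + x)
  e = solve-∀

-- Labelled pieces and their ratios

-- Rooted pieces of a tree of stars: an IsA piece hangs from a centre, an IsB piece
-- from a vertex of degree at most two.
data IsA : Tree → Set
data IsB : Tree → Set
data Hub : Tree → Set

data IsA where
  node : ∀ {q z} → Hub q → IsB z → IsA (q ◁ z)

data IsB where
  leaf : IsB •
  stem : ∀ {a} → IsA a → IsB (• ◁ a)

data Hub where
  bare : Hub •
  arms : ∀ {q} → IsA q → Hub q

-- The golden section is the fixed point of the decreasing map r ↦ 1/(1 + r), which turns the ratio
-- at a root into the ratio at a new vertex placed above it. So A and B lie on opposite sides, and
-- further arms only lower the ratio of a centre.
A-below : ∀ {a} → IsA a → Below (f₁ a) (f₀ a)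
B-above : ∀ {z} → IsB z → Above (f₁ z) (f₀ z)

B-out-below : ∀ {z} → IsB z → Below (f₀ z) (ftot z)
B-out-below {z} zB = shift-< (B-above zB) (e (f₀ z) (f₁ z))
  where
  e : ∀ a b → a * a + a * (a + b) + (b * b + b * a) ≡ (a + b) * (a + b) + a * a
  e = solve-∀

A-below (node {z = z} bare zB) = subst₂ Below (sym (*-identityˡ (f₀ z))) (sym (*-identityˡ (ftot z))) (B-out-below zB)
A-below (node {q} {z} (arms qA) zB) = Below-◁ q z (A-below qA)

B-above leaf          = s≤s (s≤s z≤n)
B-above (stem {a} aA) = shift-< (A-below aA) (e (f₀ a) (f₁ a))
  where
  e : ∀ a b → (1 * (a + b)) * (1 * (a + b)) + a * a
              ≡ (1 * a) * (1 * a) + (1 * a) * (1 * (a + b)) + (b * b + b * a)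
  e = solve-∀

-- Avoiding a centre costs nothing because each arm prefers its own B-root; a B-root is gained on
-- top of a maximum stable set of the A-piece below it.
A-α : ∀ {a} → IsA a → α₁ a ≤ α₀ a
B-α : ∀ {z} → IsB z → α₁ z ≡ suc (α₀ z)
A-α (node {z = z} bare zB)  = ≤-trans (≤-reflexive (sym (B-α zB))) (m≤n⊔m (α₀ z) (α₁ z))
A-α (node (arms qA) zB)     = +-mono-≤ (A-α qA) (m≤m⊔n _ _)
B-α leaf      = refl
B-α (stem aA) = cong suc (sym (m≥n⇒m⊔n≡m (A-α aA)))

-- The hypothesis says that some maximum stable set of s avoids the root.
α-free : ∀ t s → α₁ s ≤ α₀ s → αtot (t ◁ s) ≡ αtot t + αtot s
α-free t s le rewrite m≥n⇒m⊔n≡m le = sym (+-distribʳ-⊔ (α₀ s) (α₀ t) (α₁ t))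

-- X ◁ z, rerooted at the leaf of z reached by descending to the last child.
leafRoot : ∀ {z} → Tree → IsB z → Tree
leafRoot X leaf                  = • ◁ X
leafRoot X (stem (node {q} _ zB)) = leafRoot (q ◁ (• ◁ X)) zB

leafRoot-≈ : ∀ {z} X (zB : IsB z) → leafRoot X zB ≈ X ◁ z
leafRoot-≈ X leaf                      = ◁-comm • X
leafRoot-≈ X (stem (node {q} {z} _ zB)) = ≈-trans (leafRoot-≈ _ zB) (≈-sym (reroot X q z))

-- During the descent the ratio is alternately above and below the golden section, as for B- and
-- A-pieces; the leaf is on the upper side.
leafRoot-above : ∀ {z} X (zB : IsB z) → Below (f₁ X) (f₀ X) → Above (f₁ (leafRoot X zB)) (f₀ (leafRoot X zB))
leafRoot-above X leaf lt = shift-< lt (e (f₀ X) (f₁ X))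
  where
  e : ∀ x y → (1 * (x + y)) * (1 * (x + y)) + x * x
              ≡ (1 * x) * (1 * x) + (1 * x) * (1 * (x + y)) + (y * y + y * x)
  e = solve-∀
leafRoot-above X (stem (node bare zB)) lt = leafRoot-above _ zB (shift-< lt (e (f₀ X) (f₁ X)))
  where
  e : ∀ x y → (1 * (1 * (x + y))) * (1 * (1 * (x + y))) + (1 * (1 * (x + y))) * (1 * (1 * (x + y) + 1 * x)) + x * x
              ≡ (1 * (1 * (x + y) + 1 * x)) * (1 * (1 * (x + y) + 1 * x)) + (y * y + y * x)
  e = solve-∀
leafRoot-above X (stem (node {q} (arms qA) zB)) lt =
  leafRoot-above _ zB (Below-◁ q (• ◁ X) (A-below qA))

-- The second alternative is the case of a path z.
leafRoot-dichotomy : ∀ {z} X (zB : IsB z) →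
  Above (f₁ (leafRoot X zB)) (f₀ (leafRoot X zB)) ⊎
  (∃[ b ] b + f₁ z ≡ f₀ z × f₁ (leafRoot X zB) ≡ f₀ X * f₁ z + f₁ X * b)
leafRoot-dichotomy X leaf = inj₂ (0 , refl , e (f₀ X) (f₁ X))
  where
  e : ∀ x y → 1 * x ≡ x * 1 + y * 0
  e = solve-∀
leafRoot-dichotomy X (stem (node {q} (arms qA) zB)) =
  inj₁ (leafRoot-above _ zB (Below-◁ q (• ◁ X) (A-below qA)))
leafRoot-dichotomy X (stem (node {z = z} bare zB)) with leafRoot-dichotomy (• ◁ (• ◁ X)) zB
... | inj₁ hi = inj₁ hi
... | inj₂ (b , b+f₁≡f₀ , N≡) = inj₂ (f₀ z , e₁ (f₀ z) (f₁ z) , trans N≡ (trans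
        (e₂ (f₀ X) (f₁ X) (f₁ z) b)
        (cong (λ w → f₀ X * (1 * (1 * (w + f₁ z))) + f₁ X * w) b+f₁≡f₀)))
  where
  e₁ : ∀ a c → a + 1 * (1 * (a + c)) ≡ 1 * (1 * (a + c) + 1 * a)
  e₁ = solve-∀
  e₂ : ∀ x y c b → (1 * (1 * (x + y) + 1 * x)) * c + (1 * (1 * (x + y))) * b
                   ≡ x * (1 * (1 * ((b + c) + c))) + y * (b + c)
  e₂ = solve-∀

-- At the root of `X` the arm `z` alone pushes the ratio below the golden section. If the ratio at
-- the leaf is above it, equal totals decide; otherwise `z` is a path.
leafRoot-better : ∀ {z} X (zB : IsB z) → f₁ X < f₀ X → f₁ (X ◁ z) < f₁ (leafRoot X zB)
leafRoot-better {z} X zB lt with leafRoot-dichotomy X zB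
... | inj₁ hi = Below-Above total
        (Below-scale′ {f₀ z} {ftot z} (B-out-below zB) (<⇒≤ lt) (f₀>0 X)) hi
  where
  total : f₁ (X ◁ z) + f₀ (X ◁ z) ≡ f₁ (leafRoot X zB) + f₀ (leafRoot X zB)
  total = trans (+-comm (f₁ (X ◁ z)) _) (trans (sym (_≈_.f≡ (leafRoot-≈ X zB))) (+-comm (f₀ (leafRoot X zB)) _))
-- For the path `z`, `b` counts the stable sets containing the far end but not the root. Both sides
-- share the term `f₁ X * b`.
... | inj₂ (b , b+f₁≡f₀ , N≡) = begin-strict
  f₁ X * f₀ z                ≡⟨ cong (f₁ X *_) b+f₁≡f₀ ⟨
  f₁ X * (b + f₁ z)          ≡⟨ *-distribˡ-+ (f₁ X) b (f₁ z) ⟩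
  f₁ X * b + f₁ X * f₁ z     <⟨ +-monoʳ-< (f₁ X * b) (*-monoˡ-< (f₁ z) {{>-nonZero (f₁>0 z)}} lt) ⟩
  f₁ X * b + f₀ X * f₁ z     ≡⟨ +-comm (f₁ X * b) _ ⟩
  f₀ X * f₁ z + f₁ X * b     ≡⟨ N≡ ⟨
  f₁ (leafRoot X zB)         ∎
  where open ≤-Reasoning

-- Stated without subtraction.
ftot-edge : ∀ t s → ftot (t ◁ s) + f₁ t * f₁ s ≡ ftot t * ftot s
ftot-edge t s = e (f₀ t) (f₁ t) (f₀ s) (f₁ s)
  where
  e : ∀ a b c d → a * (c + d) + b * c + b * d ≡ (a + b) * (c + d)
  e = solve-∀

-- With the totals fixed, `ftot-edge` leaves only the subtracted product to compare.
ftot-edge-< : ∀ {t t′ s s′} → ftot t′ ≡ ftot t → ftot s′ ≡ ftot s →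
  f₁ t * f₁ s < f₁ t′ * f₁ s′ → ftot (t′ ◁ s′) < ftot (t ◁ s)
ftot-edge-< {t} {t′} {s} {s′} p q lt = shift-< lt
  (trans (ftot-edge t′ s′) (trans (cong₂ _*_ p q) (sym (ftot-edge t s))))

-- `y` moves from the root of `X` to a leaf of `z`. Being an A-piece it contributes the same to α
-- anywhere, and `leafRoot-better` gives the strict gain.
mixed-better : ∀ {X z y} → f₁ X < f₀ X → IsB z → IsA y → Better ((X ◁ z) ◁ y)
mixed-better {X} {z} {y} lt zB yA = better (u ◁ y) (cong (_+ size y) (_≈_.size≡ u≈))
  (trans (α-free u y (A-α yA)) (trans (cong (_+ αtot y) (_≈_.α≡ u≈)) (sym (α-free (X ◁ z) y (A-α yA)))))
  (ftot-edge-< {X ◁ z} {u} {y} {y} (_≈_.f≡ u≈) refl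
    (*-monoˡ-< (f₁ y) {{>-nonZero (f₁>0 y)}} (leafRoot-better X zB lt)))
  where
  u  = leafRoot X zB
  u≈ = leafRoot-≈ X zB

-- Rearranging two A-children

-- The leaf reached by descending to the last child is removed from y, its
-- neighbour becomes the root, and E is attached to the former root.
neighbourRoot : ∀ {y} → IsA y → Tree → Tree
neighbourRoot (node {q} _ leaf)      E = q ◁ E
neighbourRoot (node {q} _ (stem aA)) E = neighbourRoot aA (• ◁ (q ◁ E))

-- The version with nothing attached, separate because there is no empty `Tree`; after one step
-- `• ◁ q` plays the part of `E`.
neighbourRoot₀ : ∀ {y} → IsA y → Tree
neighbourRoot₀ (node {q} _ leaf)      = q
neighbourRoot₀ (node {q} _ (stem aA)) = neighbourRoot aA (• ◁ q)

neighbourRoot-IsA : ∀ {y E} (yA : IsA y) → IsB E → IsA (neighbourRoot yA E)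
neighbourRoot-IsA (node h leaf)      EB = node h EB
neighbourRoot-IsA (node h (stem aA)) EB = neighbourRoot-IsA aA (stem (node h EB))

descend : ∀ q a E → (q ◁ (• ◁ a)) ◁ E ≈ a ◁ (• ◁ (q ◁ E))
descend q a E = ≈-trans (≈ʳ⇒≈ (◁-swap q _ E)) (≈-trans (◁-comm (q ◁ E) _)
  (≈-trans (≈ʳ⇒≈ (◁-swap • a (q ◁ E))) (◁-comm (• ◁ (q ◁ E)) a)))

descend₀ : ∀ q a → q ◁ (• ◁ a) ≈ a ◁ (• ◁ q)
descend₀ q a = ≈-trans (◁-comm q _) (≈-trans (≈ʳ⇒≈ (◁-swap • a q)) (◁-comm (• ◁ q) a))

neighbourRoot-≈ : ∀ {y} (yA : IsA y) E → neighbourRoot yA E ◁ • ≈ y ◁ E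
neighbourRoot-≈ (node {q} _ leaf)          E = ≈ʳ⇒≈ (◁-swap q E •)
neighbourRoot-≈ (node {q} _ (stem {a} aA)) E = ≈-trans (neighbourRoot-≈ aA _) (≈-sym (descend q a E))

neighbourRoot₀-≈ : ∀ {y} (yA : IsA y) → neighbourRoot₀ yA ◁ • ≈ y
neighbourRoot₀-≈ (node {q} _ leaf)          = ≈-refl
neighbourRoot₀-≈ (node {q} _ (stem {a} aA)) = ≈-trans (neighbourRoot-≈ aA _) (≈-sym (descend₀ q a))

-- The stable sets of y minus the chosen leaf: the neighbour of that leaf is outside
-- for a and b, inside for c and d; the root of y is outside for a and c, inside for b and d.
record Counts {y} (yA : IsA y) : Set where
  field
    a b c d : ℕ
    d>0    : 0 < d
    f₀-nr  : ∀ E → f₀ (neighbourRoot yA E) ≡ a * ftot E + b * f₀ E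
    f₁-nr  : ∀ E → f₁ (neighbourRoot yA E) ≡ c * ftot E + d * f₀ E
    f₁-nr₀ : f₁ (neighbourRoot₀ yA) ≡ c + d
    f₀-y   : f₀ y ≡ 2 * a + c
    f₁-y   : f₁ y ≡ 2 * b + d

counts : ∀ {y} (yA : IsA y) → Counts yA
counts (node {q} _ leaf) = record
  -- The chosen leaf hangs from the root, which is therefore its neighbour; the two mixed counts
  -- vanish.
  { a = f₀ q ; b = 0 ; c = 0 ; d = f₁ q
  ; d>0    = f₁>0 q
  ; f₀-nr  = λ E → sym (+-identityʳ _)
  ; f₁-nr  = λ E → refl
  ; f₁-nr₀ = refl
  ; f₀-y   = e (f₀ q)
  ; f₁-y   = *-identityʳ (f₁ q)
  }
  where
  e : ∀ x → x * 2 ≡ 2 * x + 0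
  e = solve-∀
counts (node {q} _ (stem {a} aA)) = record
  -- The vertex between `q` and the inner piece is free when both its neighbours are outside and
  -- excluded otherwise, whence the factors two.
  { a = f₀ q * (2 * C.a + C.b) ; b = f₁ q * (C.a + C.b)
  ; c = f₀ q * (2 * C.c + C.d) ; d = f₁ q * (C.c + C.d)
  ; d>0    = *-mono-< (f₁>0 q) (<-≤-trans C.d>0 (m≤n+m _ _))
  ; f₀-nr  = λ E → trans (C.f₀-nr _) (e₁ C.a C.b (f₀ q) (f₁ q) (f₀ E) (f₁ E))
  ; f₁-nr  = λ E → trans (C.f₁-nr _) (e₁ C.c C.d (f₀ q) (f₁ q) (f₀ E) (f₁ E))
  ; f₁-nr₀ = trans (C.f₁-nr _) (e₂ C.c C.d (f₀ q) (f₁ q))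
  ; f₀-y   = trans (cong₂ (λ u v → f₀ q * (1 * (u + v) + 1 * u)) C.f₀-y C.f₁-y) (e₃ C.a C.b C.c C.d (f₀ q))
  ; f₁-y   = trans (cong₂ (λ u v → f₁ q * (1 * (u + v))) C.f₀-y C.f₁-y) (e₄ C.a C.b C.c C.d (f₁ q))
  }
  where
  module C = Counts (counts aA)
  e₁ : ∀ a b x y u v →
       a * (1 * (x * (u + v) + y * u) + 1 * (x * (u + v))) + b * (1 * (x * (u + v) + y * u))
       ≡ x * (2 * a + b) * (u + v) + y * (a + b) * u
  e₁ = solve-∀
  e₂ : ∀ c d x y → c * (1 * (x + y) + 1 * x) + d * (1 * (x + y)) ≡ x * (2 * c + d) + y * (c + d)
  e₂ = solve-∀
  e₃ : ∀ a b c d x → x * (1 * (2 * a + c + (2 * b + d)) + 1 * (2 * a + c))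
                     ≡ 2 * (x * (2 * a + b)) + x * (2 * c + d)
  e₃ = solve-∀
  e₄ : ∀ a b c d y → y * (1 * (2 * a + c + (2 * b + d))) ≡ 2 * (y * (a + b)) + y * (c + d)
  e₄ = solve-∀

-- a, b, c, d are the Counts of y₂, and s₀, s₁ stand for f₀ y₁, f₁ y₁.
transfer-< : ∀ {a b c d s₀ s₁} → 0 < d → 0 < s₀ →
  (2 * b + d) * s₀ ≤ s₁ * (2 * a + c) → c + d ≤ 2 * b + d →
  s₀ * (2 * a + c) < a * (s₀ + s₁ + s₀) + b * (s₀ + s₁)
transfer-< {a} {b} {c} {d} {s₀} {s₁} d>0 s₀>0 prob c+d≤ = *-cancelˡ-< 2 _ _ (begin-strict
  2 * (s₀ * (2 * a + c))                              ≡⟨ e₁ a c s₀ ⟩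
  4 * (a * s₀) + (c + c) * s₀                         ≤⟨ +-monoʳ-≤ (4 * (a * s₀)) (*-monoˡ-≤ s₀ (+-mono-≤ c≤2b c≤2b)) ⟩
  4 * (a * s₀) + (2 * b + 2 * b) * s₀                 <⟨ +-monoʳ-< (4 * (a * s₀))
                                                           (*-monoˡ-< s₀ {{>-nonZero s₀>0}} (m<m+n (2 * b + 2 * b) d>0)) ⟩
  4 * (a * s₀) + (2 * b + 2 * b + d) * s₀             ≡⟨ e₂ a b d s₀ ⟩
  4 * (a * s₀) + 2 * (b * s₀) + (2 * b + d) * s₀      ≤⟨ +-monoʳ-≤ (4 * (a * s₀) + 2 * (b * s₀)) prob ⟩
  4 * (a * s₀) + 2 * (b * s₀) + s₁ * (2 * a + c)      ≤⟨ +-monoʳ-≤ (4 * (a * s₀) + 2 * (b * s₀))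
                                                           (*-monoʳ-≤ s₁ (+-monoʳ-≤ (2 * a) c≤2b)) ⟩
  4 * (a * s₀) + 2 * (b * s₀) + s₁ * (2 * a + 2 * b)  ≡⟨ e₃ a b s₀ s₁ ⟩
  2 * (a * (s₀ + s₁ + s₀) + b * (s₀ + s₁))            ∎)
  where
  open ≤-Reasoning
  c≤2b : c ≤ 2 * b
  c≤2b = +-cancelʳ-≤ d c (2 * b) c+d≤
  e₁ : ∀ a c s₀ → 2 * (s₀ * (2 * a + c)) ≡ 4 * (a * s₀) + (c + c) * s₀
  e₁ = solve-∀
  e₂ : ∀ a b d s₀ → 4 * (a * s₀) + (2 * b + 2 * b + d) * s₀ ≡ 4 * (a * s₀) + 2 * (b * s₀) + (2 * b + d) * s₀
  e₂ = solve-∀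
  e₃ : ∀ a b s₀ s₁ → 4 * (a * s₀) + 2 * (b * s₀) + s₁ * (2 * a + 2 * b) ≡ 2 * (a * (s₀ + s₁ + s₀) + b * (s₀ + s₁))
  e₃ = solve-∀

αtot-B : ∀ {z} → IsB z → αtot z ≡ suc (α₀ z)
αtot-B {z} zB = trans (m≤n⇒m⊔n≡n (≤-trans (n≤1+n (α₀ z)) (≤-reflexive (sym (B-α zB))))) (B-α zB)

-- The right side exceeds the left by (x - y)(a - b).
rearrange : ∀ {y x b a} → y < x → b < a → x * b + y * a < x * a + y * b
rearrange {y} {x} {b} {a} y<x b<a with m≤n⇒∃[o]m+o≡n (<⇒≤ y<x) | m≤n⇒∃[o]m+o≡n (<⇒≤ b<a)
... | u , refl | v , refl = subst ((y + u) * b + y * (b + v) <_) (e y u b v)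
        (m<m+n _ (*-mono-< (+-cancelˡ-< y 0 u (subst (_< y + u) (sym (+-identityʳ y)) y<x))
                           (+-cancelˡ-< b 0 v (subst (_< b + v) (sym (+-identityʳ b)) b<a))))
  where
  e : ∀ y u b v → (y + u) * b + y * (b + v) + u * v ≡ (y + u) * (b + v) + y * b
  e = solve-∀

twoA-better′ : ∀ {X y₁ y₂} → f₁ X < f₀ X → IsA y₁ → IsA y₂ → f₁ y₂ * f₀ y₁ ≤ f₁ y₁ * f₀ y₂ →
  Better ((X ◁ y₁) ◁ y₂)
twoA-better′ {X} {y₁} {y₂} lt y₁A y₂A prob with f₁ (neighbourRoot₀ y₂A ◁ •) ≤? f₁ y₂
... | no ¬le = better (X ◁ y₁ ◁ k) (cong (size (X ◁ y₁) +_) (_≈_.size≡ k≈))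
        -- A vertex next to a leaf can be exchanged for that leaf, so some maximum stable set of `k`
        -- avoids its root.
        (trans (α-free (X ◁ y₁) k (≤-trans (≤-reflexive (+-identityʳ _))
          (≤-trans (α₁≤1+α₀ (neighbourRoot₀ y₂A)) (≤-reflexive (+-comm 1 _)))))
        (trans (cong (αtot (X ◁ y₁) +_) (_≈_.α≡ k≈)) (sym (α-free (X ◁ y₁) y₂ (A-α y₂A)))))
        (ftot-edge-< {X ◁ y₁} {X ◁ y₁} {y₂} {k} refl (_≈_.f≡ k≈)
          (*-monoʳ-< (f₁ (X ◁ y₁)) {{>-nonZero (f₁>0 (X ◁ y₁))}} (≰⇒> ¬le)))
  where
  k  = neighbourRoot₀ y₂A ◁ •
  k≈ = neighbourRoot₀-≈ y₂A
-- The root of `X` takes the place of the removed leaf; the `•` of `E` is the old branching vertex,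
-- which keeps only `y₁` and `y₂`.
... | yes le = better (X ◁ k)
        (trans (cong (size X +_) size-k) (sym (+-assoc (size X) _ _)))
        α-eq
        f-lt
  where
  open Counts (counts y₂A)
  E  = • ◁ y₁
  k  = neighbourRoot y₂A E
  kA = neighbourRoot-IsA y₂A (stem y₁A)
  k≈ = neighbourRoot-≈ y₂A E
  size-k : size k ≡ size y₁ + size y₂
  size-k = +-cancelʳ-≡ 1 _ _ (trans (_≈_.size≡ k≈) (e (size y₁) (size y₂)))
    where
    e : ∀ m n → n + (1 + m) ≡ m + n + 1
    e = solve-∀
  -- Restoring the removed leaf turns `k` into `y₂ ◁ E`. That leaf adds one to α on one side, the
  -- `•` of `E` adds one on the other.
  α-k : αtot k ≡ αtot y₁ + αtot y₂
  α-k = suc-injective (begin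
    suc (αtot k)             ≡⟨ cong suc (m≥n⇒m⊔n≡m (A-α kA)) ⟩
    suc (α₀ k)               ≡⟨ +-comm 1 (α₀ k) ⟩
    α₀ k + 1                 ≡⟨ m≥n⇒m⊔n≡m (+-mono-≤ (A-α kA) z≤n) ⟨
    αtot (k ◁ •)             ≡⟨ _≈_.α≡ k≈ ⟩
    αtot (y₂ ◁ E)            ≡⟨ _≈_.α≡ (◁-comm y₂ E) ⟩
    αtot (E ◁ y₂)            ≡⟨ α-free E y₂ (A-α y₂A) ⟩
    αtot E + αtot y₂         ≡⟨ cong (_+ αtot y₂) (αtot-B (stem y₁A)) ⟩
    suc (αtot y₁ + αtot y₂)  ∎)
    where open ≡-Reasoning
  α-eq : αtot (X ◁ k) ≡ αtot (X ◁ y₁ ◁ y₂)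
  α-eq = trans (α-free X k (A-α kA)) (trans (cong (αtot X +_) α-k) (trans (sym (+-assoc (αtot X) _ _))
    (sym (trans (α-free (X ◁ y₁) y₂ (A-α y₂A)) (cong (_+ αtot y₂) (α-free X y₁ (A-α y₁A)))))))
  f-lt : ftot (X ◁ k) < ftot (X ◁ y₁ ◁ y₂)
  -- The decrease is the product of `f₀ X` - `f₁ X` and `f₀ k` - `f₀ y₁ * f₀ y₂`; the second factor
  -- is positive by `transfer-<`.
  f-lt = shift-< (rearrange lt (subst (f₀ y₁ * f₀ y₂ <_) (sym k₀≡) k₀>))
    (trans (e₁ (f₀ X) (f₁ X) (f₀ k) (f₁ k) (f₀ y₁) (f₀ y₂))
    (trans (cong (λ w → f₀ X * w + (f₁ X * f₀ k + f₁ X * (f₀ y₁ * f₀ y₂))) (_≈_.f≡ k≈))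
           (e₂ (f₀ X) (f₁ X) (f₀ k) (f₀ y₁) (f₁ y₁) (f₀ y₂) (f₁ y₂))))
    where
    k₀≡ : f₀ k ≡ a * (f₀ y₁ + f₁ y₁ + f₀ y₁) + b * (f₀ y₁ + f₁ y₁)
    k₀≡ = trans (f₀-nr E) (e (f₀ y₁) (f₁ y₁) a b)
      where
      e : ∀ s t a b → a * (1 * (s + t) + 1 * s) + b * (1 * (s + t)) ≡ a * (s + t + s) + b * (s + t)
      e = solve-∀
    k₀> : f₀ y₁ * f₀ y₂ < a * (f₀ y₁ + f₁ y₁ + f₀ y₁) + b * (f₀ y₁ + f₁ y₁)
    k₀> = subst (λ w → f₀ y₁ * w < a * (f₀ y₁ + f₁ y₁ + f₀ y₁) + b * (f₀ y₁ + f₁ y₁)) (sym f₀-y)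
      (transfer-< {a} {b} {c} {d} {f₀ y₁} {f₁ y₁} d>0 (f₀>0 y₁)
      (subst₂ (λ u v → v * f₀ y₁ ≤ f₁ y₁ * u) f₀-y f₁-y prob)
      (subst₂ _≤_ (trans (*-identityʳ _) f₁-nr₀) f₁-y le))
    e₁ : ∀ x y k₀ k₁ s c → x * (k₀ + k₁) + y * k₀ + (x * k₀ + y * (s * c))
         ≡ x * (k₀ * 2 + k₁ * 1) + (y * k₀ + y * (s * c))
    e₁ = solve-∀
    e₂ : ∀ x y k₀ s t c d → x * (c * (1 * (s + t) + 1 * s) + d * (1 * (s + t))) + (y * k₀ + y * (s * c))
         ≡ x * (s + t) * (c + d) + y * s * c + (x * (s * c) + y * k₀)
    e₂ = solve-∀

twoA-better : ∀ {X y₁ y₂} → f₁ X < f₀ X → IsA y₁ → IsA y₂ → Better ((X ◁ y₁) ◁ y₂)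
twoA-better {X} {y₁} {y₂} lt y₁A y₂A with ≤-total (f₁ y₂ * f₀ y₁) (f₁ y₁ * f₀ y₂)
... | inj₁ le = twoA-better′ lt y₁A y₂A le
... | inj₂ ge = Better-resp (≈ʳ⇒≈ (◁-swap X y₁ y₂)) (twoA-better′ lt y₂A y₁A ge)

-- Finding an obstruction to the labelling

glue : Tree → Tree → Tree
glue X •       = X
glue X (t ◁ s) = glue X t ◁ s

glue-identityˡ : ∀ t → glue • t ≡ t
glue-identityˡ •       = refl
glue-identityˡ (t ◁ s) = cong (_◁ s) (glue-identityˡ t)

-- `glue` identifies the two roots, so a child of the common root may be assigned to either side.
glue-◁ : ∀ X t c → glue X t ◁ c ≈ʳ glue (X ◁ c) t
glue-◁ X •       c = mkʳ refl refl refl refl refl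
glue-◁ X (t ◁ s) c = ≈ʳ-trans (◁-swap (glue X t) s c) (◁-congˡ s (glue-◁ X t c))

glue-< : ∀ X t → f₁ X < f₀ X → f₁ (glue X t) < f₀ (glue X t)
glue-< X •       lt = lt
glue-< X (t ◁ s) lt = f₁<f₀ (glue X t) s

-- `AA`, `AB` and `BA` describe a vertex whose children have conflicting labels, the last two
-- differing in the order of attachment; `left` and `right` locate it.
data Fail : Tree → Set where
  AA    : ∀ {y₁ y₂} → IsA y₁ → IsA y₂ → Fail (• ◁ y₁ ◁ y₂)
  AB    : ∀ {y z} → IsA y → IsB z → Fail (• ◁ y ◁ z)
  BA    : ∀ {q y} → IsA q → IsA y → Fail (q ◁ y)
  left  : ∀ {t c} → Fail t → Fail (t ◁ c)
  right : ∀ {t c} → Fail c → Fail (t ◁ c)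

-- Labels from the leaves upwards: a B-child makes its parent a centre, and an A-child must be the
-- only child of a B-vertex. Any other combination fails.
classify : ∀ t → IsA t ⊎ IsB t ⊎ Fail t
classify • = inj₂ (inj₁ leaf)
classify (t ◁ c) with classify t | classify c
... | inj₂ (inj₂ tF)              | _                = inj₂ (inj₂ (left tF))
... | _                           | inj₂ (inj₂ cF)   = inj₂ (inj₂ (right cF))
... | inj₁ tA                     | inj₁ cA          = inj₂ (inj₂ (BA tA cA))
... | inj₁ tA                     | inj₂ (inj₁ cB)   = inj₁ (node (arms tA) cB)
... | inj₂ (inj₁ leaf)            | inj₁ cA          = inj₂ (inj₁ (stem cA))
... | inj₂ (inj₁ leaf)            | inj₂ (inj₁ cB)   = inj₁ (node bare cB)
... | inj₂ (inj₁ (stem aA))       | inj₁ cA          = inj₂ (inj₂ (AA aA cA))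
... | inj₂ (inj₁ (stem aA))       | inj₂ (inj₁ cB)   = inj₂ (inj₂ (AB aA cB))

-- X is the rest of the tree seen from the root of t; f₁ X < f₀ X says that it is
-- not a single vertex, so that the failing vertex has degree at least three.
Fail-better : ∀ {t} X → f₁ X < f₀ X → Fail t → Better (glue X t)
Fail-better X lt (AA y₁A y₂A) = twoA-better lt y₁A y₂A
Fail-better X lt (AB {y} {z} yA zB) = Better-resp (≈ʳ⇒≈ (◁-swap X y z)) (mixed-better lt zB yA)
Fail-better X lt (BA (node {q} _ zB) yA) = mixed-better (glue-< X q lt) zB yA
Fail-better X lt (left {t} {c} tF) = Better-resp (≈ʳ⇒≈ (glue-◁ X t c)) (Fail-better (X ◁ c) (f₁<f₀ X c) tF)
Fail-better X lt (right {t} {c} cF) = Better-resp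
  (≈-trans (◁-comm (glue X t) c) (subst (λ w → w ◁ glue X t ≈ glue (• ◁ glue X t) c)
    (glue-identityˡ c) (≈ʳ⇒≈ (glue-◁ • c (glue X t)))))
  (Fail-better (• ◁ glue X t) (f₁<f₀ • (glue X t)) cF)

-- Paths with an odd number of vertices, rooted at an end; the root leaf above makes the number of
-- edges odd.
data OddPathTree : Tree → Set where
  single : OddPathTree •
  extend : ∀ {z} → OddPathTree z → OddPathTree (• ◁ (• ◁ z))

-- The edge joining two B-roots moves down `z` two steps at a time. At the first branching centre
-- `• ◁ K` is an A-piece beside B-arms, the mixed obstruction; if there is none, `z` is a path.
path-or-better : ∀ {K z} → IsB K → IsB z → OddPathTree z ⊎ Better (K ◁ z)
path-or-better KB leaf = inj₁ single
path-or-better {K} KB (stem (node {z = z} bare zB)) with path-or-better (stem (node bare KB)) zB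
... | inj₁ p = inj₁ (extend p)
... | inj₂ b = inj₂ (Better-resp (reroot K • z) b)
path-or-better {K} KB (stem (node {z = z} (arms (node {q} {z′} h z′B)) zB)) =
  inj₂ (Better-resp (≈-trans (reroot K (q ◁ z′) z) (≈ʳ⇒≈ (◁-swap (q ◁ z′) (• ◁ K) z)))
    (mixed-better (f₁<f₀ q z′) zB (node bare KB)))

leaf-rooted : ∀ c → IsB (• ◁ c) ⊎ OddPathTree c ⊎ Better (• ◁ c)
leaf-rooted c with classify c
... | inj₁ cA         = inj₁ (stem cA)
... | inj₂ (inj₁ cB)  = inj₂ (path-or-better leaf cB)
... | inj₂ (inj₂ cF)  = inj₂ (inj₂ (Better-resp (≈-trans (◁-comm • c)
        (subst (λ w → w ◁ • ≈ glue (• ◁ •) c) (glue-identityˡ c) (≈ʳ⇒≈ (glue-◁ • c •))))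
        (Fail-better (• ◁ •) (f₁<f₀ • •) cF)))

-- Vertices and adjacency of a tree, and graphs realizing it

Vertex : Tree → Set
Vertex •       = ⊤
Vertex (t ◁ s) = Vertex t ⊎ Vertex s

root : ∀ t → Vertex t
root •       = tt
root (t ◁ s) = inj₁ (root t)

isRoot : ∀ t → Vertex t → Bool
isRoot •       _        = true
isRoot (t ◁ s) (inj₁ x) = isRoot t x
isRoot (t ◁ s) (inj₂ _) = false

adjᵗ : ∀ t → Vertex t → Vertex t → Bool
adjᵗ •       _        _        = false
adjᵗ (t ◁ s) (inj₁ x) (inj₁ y) = adjᵗ t x y
adjᵗ (t ◁ s) (inj₁ x) (inj₂ y) = isRoot t x ∧ isRoot s y
adjᵗ (t ◁ s) (inj₂ x) (inj₁ y) = isRoot t y ∧ isRoot s x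
adjᵗ (t ◁ s) (inj₂ x) (inj₂ y) = adjᵗ s x y

isRoot-root : ∀ t → isRoot t (root t) ≡ true
isRoot-root •       = refl
isRoot-root (t ◁ s) = isRoot-root t

isRoot⇒≡ : ∀ t x → isRoot t x ≡ true → x ≡ root t
isRoot⇒≡ •       tt       _ = refl
isRoot⇒≡ (t ◁ s) (inj₁ x) e = cong inj₁ (isRoot⇒≡ t x e)

record Realizes {n} (G : SimpleGraph n) (t : Tree) : Set where
  field
    to      : Fin n → Vertex t
    from    : Vertex t → Fin n
    from∘to : ∀ i → from (to i) ≡ i
    to∘from : ∀ x → to (from x) ≡ x
    adj≡    : ∀ i j → adj G i j ≡ adjᵗ t (to i) (to j)

-- Counting by injections between duplicate-free lists

unique-lookup : ∀ {A : Set} {xs : List A} → Unique xs → ∀ i j → lookup xs i ≡ lookup xs j → i ≡ j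
unique-lookup (_ ∷ _)   zero    zero    _ = refl
unique-lookup (x∉ ∷ _)  zero    (suc j) e = ⊥-elim (All.lookup x∉ (∈-lookup j) e)
unique-lookup (x∉ ∷ _)  (suc i) zero    e = ⊥-elim (All.lookup x∉ (∈-lookup i) (sym e))
unique-lookup (_ ∷ xs!) (suc i) (suc j) e = cong suc (unique-lookup xs! i j e)

-- Each position in `xs` goes to the position of its image in `ys`; without duplicates in `xs` this
-- is injective, and the pigeonhole principle applies.
length-≤ : ∀ {A B : Set} {xs : List A} {ys : List B} → Unique xs → (f : A → B) →
  (∀ {x y} → f x ≡ f y → x ≡ y) → (∀ {x} → x ∈ xs → f x ∈ ys) → length xs ≤ length ys
length-≤ {xs = xs} {ys} xs! f f-inj f∈ = injective⇒≤ {f = λ i → Any.index (f∈ (∈-lookup {xs = xs} i))}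
  λ {i} {j} e → unique-lookup xs! i j (f-inj
    (trans (lookup-index (f∈ (∈-lookup {xs = xs} i)))
      (trans (cong (lookup ys) e) (sym (lookup-index (f∈ (∈-lookup {xs = xs} j)))))))

length-cartesianProduct : ∀ {A B : Set} (xs : List A) (ys : List B) →
  length (cartesianProduct xs ys) ≡ length xs * length ys
length-cartesianProduct []       ys = refl
length-cartesianProduct (x ∷ xs) ys = trans (length-++ (map (x ,_) ys))
  (cong₂ _+_ (length-map (x ,_) ys) (length-cartesianProduct xs ys))

max-upper : ∀ {A : Set} (f : A → ℕ) {xs x} → x ∈ xs → f x ≤ foldr _⊔_ 0 (map f xs)
max-upper f (here refl) = m≤m⊔n _ _
max-upper f (there x∈)  = ≤-trans (max-upper f x∈) (m≤n⊔m _ _)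

max-least : ∀ {A : Set} (f : A → ℕ) xs {k} → (∀ {x} → x ∈ xs → f x ≤ k) → foldr _⊔_ 0 (map f xs) ≤ k
max-least f []       h = z≤n
max-least f (x ∷ xs) h = ⊔-lub (h (here refl)) (max-least f xs (h ∘ there))

-- Labellings of the vertices of a tree

-- A first-order form of functions `Vertex t → Bool`: pointwise equality gives equality without
-- function extensionality.
Lab : Tree → Set
Lab •       = Bool
Lab (t ◁ s) = Lab t × Lab s

at : ∀ t → Lab t → Vertex t → Bool
at •       b       _        = b
at (t ◁ s) (l , m) (inj₁ x) = at t l x
at (t ◁ s) (l , m) (inj₂ y) = at s m y

tab : ∀ t → (Vertex t → Bool) → Lab t
tab •       f = f tt
tab (t ◁ s) f = tab t (f ∘ inj₁) , tab s (f ∘ inj₂)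

at-tab : ∀ t f x → at t (tab t f) x ≡ f x
at-tab •       f tt       = refl
at-tab (t ◁ s) f (inj₁ x) = at-tab t (f ∘ inj₁) x
at-tab (t ◁ s) f (inj₂ y) = at-tab s (f ∘ inj₂) y

at-ext : ∀ t l m → (∀ x → at t l x ≡ at t m x) → l ≡ m
at-ext •       l         m         e = e tt
at-ext (t ◁ s) (l₁ , l₂) (m₁ , m₂) e = cong₂ _,_ (at-ext t l₁ m₁ (e ∘ inj₁)) (at-ext s l₂ m₂ (e ∘ inj₂))

members : ∀ t → Lab t → List (Vertex t)
members •       true    = tt ∷ []
members •       false   = []
members (t ◁ s) (l , m) = map inj₁ (members t l) ++ map inj₂ (members s m)

weight : ∀ t → Lab t → ℕ
weight t l = length (members t l)

weight-◁ : ∀ t s l m → weight (t ◁ s) (l , m) ≡ weight t l + weight s m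
weight-◁ t s l m = trans (length-++ (map inj₁ (members t l)))
  (cong₂ _+_ (length-map inj₁ (members t l)) (length-map inj₂ (members s m)))

map-disjoint : ∀ {A B : Set} {xs : List A} {ys : List B} {v : A ⊎ B} → ¬ (v ∈ map inj₁ xs × v ∈ map inj₂ ys)
map-disjoint (p , q) with ∈-map⁻ inj₁ p | ∈-map⁻ inj₂ q
... | _ , _ , refl | _ , _ , ()

members-unique : ∀ t l → Unique (members t l)
members-unique •       true    = All.[] ∷ []
members-unique •       false   = []
members-unique (t ◁ s) (l , m) = Unique.++⁺ (Unique.map⁺ inj₁-injective (members-unique t l))
  (Unique.map⁺ inj₂-injective (members-unique s m)) map-disjoint

∈-members⁺ : ∀ t l x → at t l x ≡ true → x ∈ members t l
∈-members⁺ •       true    tt       _ = here refl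
∈-members⁺ (t ◁ s) (l , m) (inj₁ x) e = ∈-++⁺ˡ (∈-map⁺ inj₁ (∈-members⁺ t l x e))
∈-members⁺ (t ◁ s) (l , m) (inj₂ y) e = ∈-++⁺ʳ (map inj₁ (members t l)) (∈-map⁺ inj₂ (∈-members⁺ s m y e))

∈-members⁻ : ∀ t l {x} → x ∈ members t l → at t l x ≡ true
∈-members⁻ •       true    _ = refl
∈-members⁻ (t ◁ s) (l , m) p with ∈-++⁻ (map inj₁ (members t l)) p
... | inj₁ q with x , x∈ , refl ← ∈-map⁻ inj₁ q = ∈-members⁻ t l x∈
... | inj₂ q with y , y∈ , refl ← ∈-map⁻ inj₂ q = ∈-members⁻ s m y∈

-- Built along the recurrences for `f₀` and `f₁`, so the lengths come out at once; what remains is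
-- that exactly the stable sets are listed, each once.
outs ins : ∀ t → List (Lab t)
outs •       = false ∷ []
outs (t ◁ s) = cartesianProduct (outs t) (outs s ++ ins s)
ins •       = true ∷ []
ins (t ◁ s) = cartesianProduct (ins t) (outs s)

length-outs : ∀ t → length (outs t) ≡ f₀ t
length-ins  : ∀ t → length (ins t) ≡ f₁ t
length-outs •       = refl
length-outs (t ◁ s) = trans (length-cartesianProduct (outs t) _) (cong₂ _*_ (length-outs t)
  (trans (length-++ (outs s)) (cong₂ _+_ (length-outs s) (length-ins s))))
length-ins •       = refl
length-ins (t ◁ s) = trans (length-cartesianProduct (ins t) _) (cong₂ _*_ (length-ins t) (length-outs s))

Stable : ∀ t → Lab t → Set
Stable t l = ∀ x y → at t l x ≡ true → at t l y ≡ true → adjᵗ t x y ≡ false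

Stable-◁ : ∀ t s {l m} → Stable t l → Stable s m →
  (at t l (root t) ≡ true → at s m (root s) ≡ true → ⊥) → Stable (t ◁ s) (l , m)
Stable-◁ t s {l} {m} p q r = λ
  { (inj₁ x) (inj₁ y) → p x y
  ; (inj₁ x) (inj₂ y) → cross x y
  ; (inj₂ x) (inj₁ y) e e′ → cross y x e′ e
  ; (inj₂ x) (inj₂ y) → q x y }
  where
  cross : ∀ x y → at t l x ≡ true → at s m y ≡ true → isRoot t x ∧ isRoot s y ≡ false
  cross x y ex ey with isRoot t x in ex′ | isRoot s y in ey′
  ... | false | _     = refl
  ... | true  | false = refl
  ... | true  | true  rewrite isRoot⇒≡ t x ex′ | isRoot⇒≡ s y ey′ = ⊥-elim (r ex ey)

Stable-roots : ∀ t s {l m} → Stable (t ◁ s) (l , m) → at t l (root t) ≡ true → at s m (root s) ≡ false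
Stable-roots t s {l} {m} p e with at s m (root s) in e′
... | false = refl
... | true  with () ← trans (sym (cong₂ _∧_ (isRoot-root t) (isRoot-root s))) (p (inj₁ (root t)) (inj₂ (root s)) e e′)

true≢false : ∀ {b} → b ≡ true → b ≡ false → ⊥
true≢false refl ()

outs-sound : ∀ t {l} → l ∈ outs t → Stable t l × at t l (root t) ≡ false
ins-sound  : ∀ t {l} → l ∈ ins t → Stable t l × at t l (root t) ≡ true

both-sound : ∀ t {l} → l ∈ outs t ++ ins t → Stable t l
both-sound t l∈ with ∈-++⁻ (outs t) l∈
... | inj₁ l∈outs = proj₁ (outs-sound t l∈outs)
... | inj₂ l∈ins  = proj₁ (ins-sound t l∈ins)

outs-sound • (here refl) = (λ _ _ _ _ → refl) , refl
outs-sound (t ◁ s) {l , m} lm∈ with l∈ , m∈ ← ∈-cartesianProduct⁻ (outs t) _ lm∈ =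
  Stable-◁ t s (proj₁ (outs-sound t l∈)) (both-sound s m∈)
    (λ e _ → true≢false e (proj₂ (outs-sound t l∈))) , proj₂ (outs-sound t l∈)
ins-sound • (here refl) = (λ _ _ _ _ → refl) , refl
ins-sound (t ◁ s) {l , m} lm∈ with l∈ , m∈ ← ∈-cartesianProduct⁻ (ins t) _ lm∈ =
  Stable-◁ t s (proj₁ (ins-sound t l∈)) (proj₁ (outs-sound s m∈))
    (λ _ e → true≢false e (proj₂ (outs-sound s m∈))) , proj₂ (ins-sound t l∈)

outs-complete : ∀ t {l} → Stable t l → at t l (root t) ≡ false → l ∈ outs t
ins-complete  : ∀ t {l} → Stable t l → at t l (root t) ≡ true → l ∈ ins t

both-complete : ∀ t {l} → Stable t l → l ∈ outs t ++ ins t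
both-complete t {l} p with at t l (root t) in e
... | false = ∈-++⁺ˡ (outs-complete t p e)
... | true  = ∈-++⁺ʳ (outs t) (ins-complete t p e)

outs-complete •       p refl = here refl
outs-complete (t ◁ s) p e    = ∈-cartesianProduct⁺ (outs-complete t (λ x y → p (inj₁ x) (inj₁ y)) e)
  (both-complete s (λ x y → p (inj₂ x) (inj₂ y)))
ins-complete •       p refl = here refl
ins-complete (t ◁ s) p e    = ∈-cartesianProduct⁺ (ins-complete t (λ x y → p (inj₁ x) (inj₁ y)) e)
  (outs-complete s (λ x y → p (inj₂ x) (inj₂ y)) (Stable-roots t s p e))

outs-unique : ∀ t → Unique (outs t)
ins-unique  : ∀ t → Unique (ins t)

both-unique : ∀ t → Unique (outs t ++ ins t)
both-unique t = Unique.++⁺ (outs-unique t) (ins-unique t)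
  λ (p , q) → true≢false (proj₂ (ins-sound t q)) (proj₂ (outs-sound t p))

outs-unique •       = All.[] ∷ []
outs-unique (t ◁ s) = Unique.cartesianProduct⁺ (outs-unique t) (both-unique s)
ins-unique •       = All.[] ∷ []
ins-unique (t ◁ s) = Unique.cartesianProduct⁺ (ins-unique t) (outs-unique s)

outs-weight : ∀ t {l} → l ∈ outs t → weight t l ≤ α₀ t
ins-weight  : ∀ t {l} → l ∈ ins t → weight t l ≤ α₁ t

both-weight : ∀ t {l} → l ∈ outs t ++ ins t → weight t l ≤ αtot t
both-weight t l∈ with ∈-++⁻ (outs t) l∈
... | inj₁ p = ≤-trans (outs-weight t p) (m≤m⊔n _ _)
... | inj₂ p = ≤-trans (ins-weight t p) (m≤n⊔m (α₀ t) _)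

outs-weight • (here refl) = z≤n
outs-weight (t ◁ s) {l , m} lm∈ with l∈ , m∈ ← ∈-cartesianProduct⁻ (outs t) _ lm∈ =
  ≤-trans (≤-reflexive (weight-◁ t s l m)) (+-mono-≤ (outs-weight t l∈) (both-weight s m∈))
ins-weight • (here refl) = ≤-refl
ins-weight (t ◁ s) {l , m} lm∈ with l∈ , m∈ ← ∈-cartesianProduct⁻ (ins t) _ lm∈ =
  ≤-trans (≤-reflexive (weight-◁ t s l m)) (+-mono-≤ (ins-weight t l∈) (outs-weight s m∈))

-- With the weight bounds, this shows that the recursively defined α-values are true maxima.
outs-max : ∀ t → ∃[ l ] l ∈ outs t × weight t l ≡ α₀ t
ins-max  : ∀ t → ∃[ l ] l ∈ ins t × weight t l ≡ α₁ t

both-max : ∀ t → ∃[ l ] l ∈ outs t ++ ins t × weight t l ≡ αtot t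
both-max t with ⊔-sel (α₀ t) (α₁ t) | outs-max t | ins-max t
... | inj₁ e | l , l∈ , w | _ = l , ∈-++⁺ˡ l∈ , trans w (sym e)
... | inj₂ e | _ | l , l∈ , w = l , ∈-++⁺ʳ (outs t) l∈ , trans w (sym e)

outs-max •       = false , here refl , refl
outs-max (t ◁ s) with outs-max t | both-max s
... | l , l∈ , w | m , m∈ , w′ = (l , m) , ∈-cartesianProduct⁺ l∈ m∈ , trans (weight-◁ t s l m) (cong₂ _+_ w w′)
ins-max •       = true , here refl , refl
ins-max (t ◁ s) with ins-max t | outs-max s
... | l , l∈ , w | m , m∈ , w′ = (l , m) , ∈-cartesianProduct⁺ l∈ m∈ , trans (weight-◁ t s l m) (cong₂ _+_ w w′)

-- Stable sets of graphs

StableIn : ∀ {n} → SimpleGraph n → Subset n → Set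
StableIn G s = ∀ i j → Vec.lookup s i ≡ true → Vec.lookup s j ≡ true → adj G i j ≡ false

allᵇ-sound : ∀ {A : Set} (p : A → Bool) {xs} → allᵇ p xs ≡ true → ∀ {x} → x ∈ xs → p x ≡ true
allᵇ-sound p {x ∷ xs} e x∈ with p x in px
allᵇ-sound p {x ∷ xs} e (here refl) | true = px
allᵇ-sound p {x ∷ xs} e (there x∈)  | true = allᵇ-sound p e x∈

allᵇ-complete : ∀ {A : Set} (p : A → Bool) xs → (∀ x → p x ≡ true) → allᵇ p xs ≡ true
allᵇ-complete p []       h = refl
allᵇ-complete p (x ∷ xs) h rewrite h x = allᵇ-complete p xs h

isStable-sound : ∀ {n} (G : SimpleGraph n) s → isStable G s ≡ true → StableIn G s
isStable-sound G s e i j ei ej with allᵇ-sound _ (allᵇ-sound _ e (∈-allFin i)) (∈-allFin j)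
... | h rewrite ei | ej with adj G i j
...   | false = refl

isStable-complete : ∀ {n} (G : SimpleGraph n) s → StableIn G s → isStable G s ≡ true
isStable-complete {n} G s h = allᵇ-complete _ (allFin n) λ i → allᵇ-complete _ (allFin n) (cell i)
  where
  cell : ∀ i j → not (Vec.lookup s i ∧ Vec.lookup s j ∧ adj G i j) ≡ true
  cell i j with Vec.lookup s i in ei | Vec.lookup s j in ej
  ... | false | _     = refl
  ... | true  | false = refl
  ... | true  | true  rewrite h i j ei ej = refl

∷-injʳ : ∀ {n b} {s s′ : Subset n} → _≡_ {A = Subset (suc n)} (b ∷ s) (b ∷ s′) → s ≡ s′
∷-injʳ refl = refl

∈-allSubsets : ∀ {n} (s : Subset n) → s ∈ allSubsets n
∈-allSubsets []          = here refl
∈-allSubsets (false ∷ s) = ∈-++⁺ˡ (∈-map⁺ (false ∷_) (∈-allSubsets s))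
∈-allSubsets (true ∷ s)  = ∈-++⁺ʳ (map (false ∷_) (allSubsets _)) (∈-map⁺ (true ∷_) (∈-allSubsets s))

allSubsets-unique : ∀ n → Unique (allSubsets n)
allSubsets-unique zero    = All.[] ∷ []
allSubsets-unique (suc n) = Unique.++⁺ (Unique.map⁺ ∷-injʳ (allSubsets-unique n))
  (Unique.map⁺ ∷-injʳ (allSubsets-unique n)) disjoint
  where
  disjoint : ∀ {v} → ¬ (v ∈ map (false ∷_) (allSubsets n) × v ∈ map (true ∷_) (allSubsets n))
  disjoint (p , q) with ∈-map⁻ (false ∷_) p | ∈-map⁻ (true ∷_) q
  ... | _ , _ , refl | _ , _ , ()

stableSets-unique : ∀ {n} (G : SimpleGraph n) → Unique (stableSets G)
stableSets-unique {n} G = Unique.filter⁺ _ (allSubsets-unique n)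

stableSets-sound : ∀ {n} (G : SimpleGraph n) {s} → s ∈ stableSets G → StableIn G s
stableSets-sound {n} G {s} s∈ = isStable-sound G s (Equivalence.to Bool.T-≡ (proj₂ (∈-filter⁻ _ {xs = allSubsets n} s∈)))

stableSets-complete : ∀ {n} (G : SimpleGraph n) {s} → StableIn G s → s ∈ stableSets G
stableSets-complete G {s} h = ∈-filter⁺ _ (∈-allSubsets s) (Equivalence.from Bool.T-≡ (isStable-complete G s h))

elements : ∀ {n} → Subset n → List (Fin n)
elements []          = []
elements (true ∷ s)  = zero ∷ map suc (elements s)
elements (false ∷ s) = map suc (elements s)

length-elements : ∀ {n} (s : Subset n) → length (elements s) ≡ ∣ s ∣
length-elements []          = refl
length-elements (true ∷ s)  = cong suc (trans (length-map suc (elements s)) (length-elements s))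
length-elements (false ∷ s) = trans (length-map suc (elements s)) (length-elements s)

elements-unique : ∀ {n} (s : Subset n) → Unique (elements s)
elements-unique []          = []
elements-unique (true ∷ s)  = All.tabulate (λ p e → zero∉ (subst (_∈ _) (sym e) p))
                              ∷ Unique.map⁺ sucᶠ-injective (elements-unique s)
  where
  zero∉ : ¬ (zero ∈ map suc (elements s))
  zero∉ p with ∈-map⁻ suc p
  ... | _ , _ , ()
elements-unique (false ∷ s) = Unique.map⁺ sucᶠ-injective (elements-unique s)

∈-elements⁺ : ∀ {n} (s : Subset n) i → Vec.lookup s i ≡ true → i ∈ elements s
∈-elements⁺ (true ∷ s)  zero    e = here refl
∈-elements⁺ (true ∷ s)  (suc i) e = there (∈-map⁺ suc (∈-elements⁺ s i e))
∈-elements⁺ (false ∷ s) (suc i) e = ∈-map⁺ suc (∈-elements⁺ s i e)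

∈-elements⁻ : ∀ {n} (s : Subset n) {i} → i ∈ elements s → Vec.lookup s i ≡ true
∈-elements⁻ (true ∷ s) (here refl) = refl
∈-elements⁻ (true ∷ s) (there p) with _ , q , refl ← ∈-map⁻ suc p = ∈-elements⁻ s q
∈-elements⁻ (false ∷ s) p with _ , q , refl ← ∈-map⁻ suc p = ∈-elements⁻ s q

module _ {n} {G : SimpleGraph n} {t : Tree} (R : Realizes G t) where
  open Realizes R

  label : Subset n → Lab t
  label s = tab t (Vec.lookup s ∘ from)

  subset : Lab t → Subset n
  subset l = Vec.tabulate (at t l ∘ to)

  at-label : ∀ s x → at t (label s) x ≡ Vec.lookup s (from x)
  at-label s = at-tab t (Vec.lookup s ∘ from)

  lookup-subset : ∀ l i → Vec.lookup (subset l) i ≡ at t l (to i)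
  lookup-subset l = Vec.lookup∘tabulate (at t l ∘ to)

  subset-label : ∀ s → subset (label s) ≡ s
  subset-label s = trans (Vec.tabulate-cong λ i → trans (at-label s (to i)) (cong (Vec.lookup s) (from∘to i)))
    (Vec.tabulate∘lookup s)

  label-subset : ∀ l → label (subset l) ≡ l
  label-subset l = at-ext t _ l λ x →
    trans (at-label (subset l) x) (trans (lookup-subset l (from x)) (cong (at t l) (to∘from x)))

  to-injective : ∀ {i j} → to i ≡ to j → i ≡ j
  to-injective {i} {j} e = trans (sym (from∘to i)) (trans (cong from e) (from∘to j))

  from-injective : ∀ {x y} → from x ≡ from y → x ≡ y
  from-injective {x} {y} e = trans (sym (to∘from x)) (trans (cong to e) (to∘from y))

  label-stable : ∀ s → StableIn G s → Stable t (label s)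
  label-stable s h x y ex ey = trans (sym (trans (adj≡ (from x) (from y)) (cong₂ (adjᵗ t) (to∘from x) (to∘from y))))
    (h (from x) (from y) (trans (sym (at-label s x)) ex) (trans (sym (at-label s y)) ey))

  subset-stable : ∀ l → Stable t l → StableIn G (subset l)
  subset-stable l h i j ei ej = trans (adj≡ i j)
    (h (to i) (to j) (trans (sym (lookup-subset l i)) ei) (trans (sym (lookup-subset l j)) ej))

  ∣subset∣ : ∀ l → ∣ subset l ∣ ≡ weight t l
  ∣subset∣ l = trans (sym (length-elements (subset l))) (≤-antisym
    (length-≤ (elements-unique (subset l)) to to-injective
      λ {i} p → ∈-members⁺ t l (to i) (trans (sym (lookup-subset l i)) (∈-elements⁻ (subset l) p)))
    (length-≤ (members-unique t l) from from-injective
      λ {x} p → ∈-elements⁺ (subset l) (from x)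
        (trans (lookup-subset l (from x)) (trans (cong (at t l) (to∘from x)) (∈-members⁻ t l p)))))

  -- `label` and `subset` inject the stable sets of `G` and those listed for `t` into each other.
  F-realizes : F G ≡ ftot t
  F-realizes = trans (≤-antisym
    (length-≤ (stableSets-unique G) label
      (λ {s} {s′} e → trans (sym (subset-label s)) (trans (cong subset e) (subset-label s′)))
      (λ {s} s∈ → both-complete t (label-stable s (stableSets-sound G s∈))))
    (length-≤ (both-unique t) subset
      (λ {l} {l′} e → trans (sym (label-subset l)) (trans (cong label e) (label-subset l′)))
      (λ {l} l∈ → stableSets-complete G (subset-stable l (both-sound t l∈)))))
    (trans (length-++ (outs t)) (cong₂ _+_ (length-outs t) (length-ins t)))

  α-realizes : α G ≡ αtot t
  α-realizes = ≤-antisym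
    (max-least ∣_∣ (stableSets G) λ {s} s∈ → ≤-trans
      (≤-reflexive (trans (cong ∣_∣ (sym (subset-label s))) (∣subset∣ (label s))))
      (both-weight t (both-complete t (label-stable s (stableSets-sound G s∈)))))
    (attained (both-max t))
    where
    attained : (∃[ l ] l ∈ outs t ++ ins t × weight t l ≡ αtot t) → αtot t ≤ α G
    attained (l , l∈ , w) = ≤-trans (≤-reflexive (trans (sym w) (sym (∣subset∣ l))))
      (max-upper ∣_∣ {x = subset l} (stableSets-complete G (subset-stable l (both-sound t l∈))))

-- Every tree is realized by a graph that is a tree

encode : ∀ t → Vertex t → Fin (size t)
encode •       _ = zero
encode (t ◁ s) v = joinᶠ (size t) (size s) (Sum.map (encode t) (encode s) v)

decode : ∀ t → Fin (size t) → Vertex t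
decode •       _ = tt
decode (t ◁ s) i = Sum.map (decode t) (decode s) (splitAt (size t) i)

decode-encode : ∀ t x → decode t (encode t x) ≡ x
decode-encode •       tt = refl
decode-encode (t ◁ s) (inj₁ x) rewrite splitAt-join (size t) (size s) (inj₁ (encode t x)) = cong inj₁ (decode-encode t x)
decode-encode (t ◁ s) (inj₂ y) rewrite splitAt-join (size t) (size s) (inj₂ (encode s y)) = cong inj₂ (decode-encode s y)

encode-decode : ∀ t i → encode t (decode t i) ≡ i
encode-decode •       zero = refl
encode-decode (t ◁ s) i = trans (cong (joinᶠ (size t) (size s)) (lemma (splitAt (size t) i)))
  (join-splitAt (size t) (size s) i)
  where
  lemma : ∀ v → Sum.map (encode t) (encode s) (Sum.map (decode t) (decode s) v) ≡ v
  lemma (inj₁ x) = cong inj₁ (encode-decode t x)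
  lemma (inj₂ y) = cong inj₂ (encode-decode s y)

adjᵗ-sym : ∀ t x y → adjᵗ t x y ≡ adjᵗ t y x
adjᵗ-sym •       _        _        = refl
adjᵗ-sym (t ◁ s) (inj₁ x) (inj₁ y) = adjᵗ-sym t x y
adjᵗ-sym (t ◁ s) (inj₁ x) (inj₂ y) = refl
adjᵗ-sym (t ◁ s) (inj₂ x) (inj₁ y) = refl
adjᵗ-sym (t ◁ s) (inj₂ x) (inj₂ y) = adjᵗ-sym s x y

adjᵗ-irrefl : ∀ t x → adjᵗ t x x ≡ false
adjᵗ-irrefl •       _        = refl
adjᵗ-irrefl (t ◁ s) (inj₁ x) = adjᵗ-irrefl t x
adjᵗ-irrefl (t ◁ s) (inj₂ y) = adjᵗ-irrefl s y

graph : ∀ t → SimpleGraph (size t)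
graph t = record
  { adj    = λ i j → adjᵗ t (decode t i) (decode t j)
  ; sym    = λ i j → adjᵗ-sym t (decode t i) (decode t j)
  ; irrefl = λ i → adjᵗ-irrefl t (decode t i)
  }

graph-realizes : ∀ t → Realizes (graph t) t
graph-realizes t = record
  { to = decode t ; from = encode t
  ; from∘to = encode-decode t ; to∘from = decode-encode t ; adj≡ = λ _ _ → refl }

module _ {n} {G : SimpleGraph n} where

  Reachable-trans : ∀ {u v w} → Reachable G u v → Reachable G v w → Reachable G u w
  Reachable-trans here       q = q
  Reachable-trans (step e p) q = step e (Reachable-trans p q)

  Reachable-sym : ∀ {u v} → Reachable G u v → Reachable G v u
  Reachable-sym here               = here
  Reachable-sym (step {u} {v} e p) = Reachable-trans (Reachable-sym p) (step (trans (adj-sym G v u) e) here)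

  -- Stated for any adjacency-preserving `f`, so that the induction can restrict it to a subtree.
  reach-root : ∀ t (f : Vertex t → Fin n) → (∀ x y → adjᵗ t x y ≡ true → Adj G (f x) (f y)) →
    ∀ x → Reachable G (f x) (f (root t))
  reach-root •       f hom tt       = here
  reach-root (t ◁ s) f hom (inj₁ x) = reach-root t (f ∘ inj₁) (λ x y → hom (inj₁ x) (inj₁ y)) x
  reach-root (t ◁ s) f hom (inj₂ y) = Reachable-trans (reach-root s (f ∘ inj₂) (λ x y → hom (inj₂ x) (inj₂ y)) y)
    (step (hom (inj₂ (root s)) (inj₁ (root t)) (cong₂ _∧_ (isRoot-root t) (isRoot-root s))) here)

  realizes-connected : ∀ {t} → Realizes G t → Connected G
  realizes-connected {t} R u v = subst₂ (Reachable G) (from∘to u) (from∘to v)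
    (Reachable-trans (reach-root t from hom (to u)) (Reachable-sym (reach-root t from hom (to v))))
    where
    open Realizes R
    hom : ∀ x y → adjᵗ t x y ≡ true → Adj G (from x) (from y)
    hom x y e = trans (adj≡ (from x) (from y)) (trans (cong₂ (adjᵗ t) (to∘from x) (to∘from y)) e)

  -- Predecessor and successor on the cycle, with wraparound at both ends; length at least three
  -- keeps them distinct.
  cycle-neighbours : (K : Cycle G) → let open Cycle K in
    ∀ i → ∃[ j ] ∃[ k ] ¬ (j ≡ k) × Adj G (c i) (c j) × Adj G (c i) (c k)
  cycle-neighbours K = neighbours
    where
    open Cycle K
    neighbours : ∀ i → ∃[ j ] ∃[ k ] ¬ (j ≡ k) × Adj G (c i) (c j) × Adj G (c i) (c k)
    neighbours zero = suc zero , fromℕ (suc (suc m)) , (λ ()) , cons zero , trans (adj-sym G _ _) close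
    neighbours (suc i) with view i
    ... | ‵fromℕ     = inject₁ (fromℕ (suc m)) , zero , (λ ()) , trans (adj-sym G _ _) (cons (fromℕ (suc m))) , close
    ... | ‵inject₁ k = inject₁ (inject₁ k) , suc (suc k) , apart , trans (adj-sym G _ _) (cons (inject₁ k)) , cons (suc k)
      where
      apart : ¬ (inject₁ (inject₁ k) ≡ suc (suc k))
      apart e = m≢1+m+n (toℕ k) {1} (trans (sym (trans (toℕ-inject₁ (inject₁ k)) (toℕ-inject₁ k)))
        (trans (cong toℕ e) (cong suc (+-comm 1 (toℕ k)))))

-- Depth and acyclicity

depth : ∀ t → Vertex t → ℕ
depth •       _        = 0
depth (t ◁ s) (inj₁ x) = depth t x
depth (t ◁ s) (inj₂ y) = suc (depth s y)

depth-root : ∀ t → depth t (root t) ≡ 0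
depth-root •       = refl
depth-root (t ◁ s) = depth-root t

∧-true : ∀ {a b} → a ∧ b ≡ true → a ≡ true × b ≡ true
∧-true {true} {true} _ = refl , refl

cross-roots : ∀ t s x y → isRoot t x ∧ isRoot s y ≡ true → x ≡ root t × y ≡ root s
cross-roots t s x y e = isRoot⇒≡ t x (proj₁ (∧-true e)) , isRoot⇒≡ s y (proj₂ (∧-true {isRoot t x} e))

depth-≢ : ∀ t x y → adjᵗ t x y ≡ true → ¬ (depth t x ≡ depth t y)
depth-≢ (t ◁ s) (inj₁ x) (inj₁ y) e d = depth-≢ t x y e d
depth-≢ (t ◁ s) (inj₂ x) (inj₂ y) e d = depth-≢ s x y e (suc-injective d)
depth-≢ (t ◁ s) (inj₁ x) (inj₂ y) e d
  with () ← trans (sym (depth-root t)) (trans (cong (depth t) (sym (proj₁ (cross-roots t s x y e)))) d)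
depth-≢ (t ◁ s) (inj₂ x) (inj₁ y) e d
  with () ← trans d (trans (cong (depth t) (proj₁ (cross-roots t s y x e))) (depth-root t))

-- The crossing edge joins the two roots, and a root of depth zero has no lower neighbour;
-- everything else happens inside one part.
parent-unique : ∀ t x y z → adjᵗ t x y ≡ true → adjᵗ t x z ≡ true →
  depth t y < depth t x → depth t z < depth t x → y ≡ z
parent-unique (t ◁ s) (inj₁ x) (inj₁ y) (inj₁ z) e e′ p q = cong inj₁ (parent-unique t x y z e e′ p q)
parent-unique (t ◁ s) (inj₂ x) (inj₂ y) (inj₂ z) e e′ p q = cong inj₂ (parent-unique s x y z e e′ (s<s⁻¹ p) (s<s⁻¹ q))
parent-unique (t ◁ s) (inj₂ x) (inj₁ y) (inj₁ z) e e′ p q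
  with refl , _ ← cross-roots t s y x e | refl , _ ← cross-roots t s z x e′ = refl
parent-unique (t ◁ s) (inj₁ x) (inj₂ y) z        e e′ p q
  with refl , _ ← cross-roots t s x y e = ⊥-elim (n≮0 (subst (_ <_) (depth-root t) p))
parent-unique (t ◁ s) (inj₁ x) (inj₁ y) (inj₂ z) e e′ p q
  with refl , _ ← cross-roots t s x z e′ = ⊥-elim (n≮0 (subst (_ <_) (depth-root t) q))
parent-unique (t ◁ s) (inj₂ x) (inj₁ y) (inj₂ z) e e′ p q
  with _ , refl ← cross-roots t s y x e = ⊥-elim (n≮0 (subst (depth s z <_) (depth-root s) (s<s⁻¹ q)))
parent-unique (t ◁ s) (inj₂ x) (inj₂ y) (inj₁ z) e e′ p q
  with _ , refl ← cross-roots t s z x e′ = ⊥-elim (n≮0 (subst (depth s y <_) (depth-root s) (s<s⁻¹ p)))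

argmax : ∀ {n} (f : Fin (suc n) → ℕ) → ∃[ i ] (∀ j → f j ≤ f i)
argmax {zero}  f = zero , λ { zero → ≤-refl }
argmax {suc n} f with argmax (f ∘ suc)
... | i , max with ≤-total (f zero) (f (suc i))
...   | inj₁ le = suc i , λ { zero → le ; (suc j) → max j }
...   | inj₂ ge = zero , λ { zero → ≤-refl ; (suc j) → ≤-trans (max j) ge }

-- A deepest vertex of a cycle would have two parents.
realizes-acyclic : ∀ {n} {G : SimpleGraph n} {t} → Realizes G t → Acyclic G
realizes-acyclic {G = G} {t} R K with argmax (depth t ∘ Realizes.to R ∘ Cycle.c K)
... | i , max with cycle-neighbours K i
...   | j , k , j≢k , ij , ik =
  j≢k (inj (to-injective R (parent-unique t _ _ _ (edge ij) (edge ik) (lower ij) (lower ik))))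
  where
  open Realizes R
  open Cycle K
  edge : ∀ {j} → Adj G (c i) (c j) → adjᵗ t (to (c i)) (to (c j)) ≡ true
  edge {j} e = trans (sym (adj≡ (c i) (c j))) e
  lower : ∀ {j} → Adj G (c i) (c j) → depth t (to (c j)) < depth t (to (c i))
  lower {j} e = ≤∧≢⇒< (max j) (depth-≢ t _ _ (edge e) ∘ sym)

size>0 : ∀ t → 1 ≤ size t
size>0 •       = ≤-refl
size>0 (t ◁ s) = ≤-trans (size>0 t) (m≤m+n _ _)

graph-isTree : ∀ t → IsTree (graph t)
graph-isTree t = size>0 t , realizes-connected (graph-realizes t) , realizes-acyclic (graph-realizes t)

-- Every `Tree` yields a competing graph, so extremality becomes a statement about invariants.
extremal-minimal : ∀ {n} {G : SimpleGraph n} {t} → Realizes G t → Extremal G →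
  ∀ u → size u ≡ n → αtot u ≡ αtot t → ftot t ≤ ftot u
extremal-minimal R (_ , minimal) u refl α≡ = subst₂ _≤_ (F-realizes R) (F-realizes (graph-realizes u))
  (minimal (graph u) (graph-isTree u) (trans (α-realizes (graph-realizes u)) (trans α≡ (sym (α-realizes R)))))

-- Leaves of a tree graph

linked-lookup : ∀ {A : Set} {R : A → A → Set} {x xs} → Linked R (x ∷ xs) →
  ∀ i → R (lookup (x ∷ xs) (inject₁ i)) (lookup (x ∷ xs) (suc i))
linked-lookup (r ∷ l) zero    = r
linked-lookup (r ∷ l) (suc i) = linked-lookup l i

-- Cuts the path off at `z`, so that an edge from `z` back to the start can close a cycle.
prefix-to : ∀ {A : Set} {R : A → A → Set} {x xs z} → z ∈ x ∷ xs → Linked R (x ∷ xs) → Unique (x ∷ xs) →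
  ∃[ ws ] Linked R (x ∷ ws) × Unique (x ∷ ws) × lookup (x ∷ ws) (fromℕ (length ws)) ≡ z × (∀ {v} → v ∈ ws → v ∈ xs)
prefix-to (here refl) l u = [] , [-] , All.[] ∷ [] , refl , λ ()
prefix-to {xs = y ∷ xs} (there z∈) (r ∷ l) (x∉ ∷ u) with prefix-to z∈ l u
... | ws , l′ , u′ , end , sub = y ∷ ws , r ∷ l′ , All.tabulate (λ v∈ → All.lookup x∉ (sub′ v∈)) ∷ u′ , end , sub′
  where
  sub′ : ∀ {v} → v ∈ y ∷ ws → v ∈ y ∷ xs
  sub′ (here e)   = here e
  sub′ (there v∈) = there (sub v∈)

module _ {n} (G : SimpleGraph n) where

  -- Taking `z` from `ys` puts at least the three vertices `x`, `y` and `z` on the cycle.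
  close-cycle : ∀ {x y ys z} → Linked (Adj G) (x ∷ y ∷ ys) → Unique (x ∷ y ∷ ys) → z ∈ ys → Adj G z x → Cycle G
  close-cycle {x} {y} {w ∷ ys} (xy ∷ (yw ∷ l)) (x∉ ∷ (y∉ ∷ u)) z∈ zx with prefix-to z∈ l u
  ... | ws , l′ , u′ , end , sub = record
    { m = length ws
    ; c = lookup (x ∷ y ∷ w ∷ ws)
    ; inj = λ {i} {j} → unique-lookup unique i j
    ; cons = linked-lookup (xy ∷ (yw ∷ l′))
    ; close = trans (cong (λ v → adj G v x) end) zx
    }
    where
    sub′ : ∀ {v} → v ∈ w ∷ ws → v ∈ w ∷ ys
    sub′ (here e)   = here e
    sub′ (there v∈) = there (sub v∈)
    sub″ : ∀ {v} → v ∈ y ∷ w ∷ ws → v ∈ y ∷ w ∷ ys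
    sub″ (here e)   = here e
    sub″ (there v∈) = there (sub′ v∈)
    unique : Unique (x ∷ y ∷ w ∷ ws)
    unique = All.tabulate (All.lookup x∉ ∘ sub″) ∷ (All.tabulate (All.lookup y∉ ∘ sub′) ∷ u′)

  record LeafOffRoot (r : Fin n) : Set where
    field
      ℓ p    : Fin n
      ℓ≢r    : ¬ (ℓ ≡ r)
      ℓp     : Adj G ℓ p
      only-p : ∀ z → Adj G ℓ z → z ≡ p

  unique-length : ∀ {xs : List (Fin n)} → Unique xs → length xs ≤ n
  unique-length u = injective⇒≤ (λ {i} {j} → unique-lookup u i j)

  -- A path that cannot be prolonged at its first vertex starts in a leaf.
  prolong : Acyclic G → ∀ {r x y ys} k → n < k + length (x ∷ y ∷ ys) →
    Linked (Adj G) (x ∷ y ∷ ys) → Unique (x ∷ y ∷ ys) →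
    r ∈ y ∷ ys → LeafOffRoot r
  -- A path without repetition has at most `n` vertices, so the fuel cannot run out.
  prolong acyc zero n< l u r∈ = ⊥-elim (<⇒≱ n< (unique-length u))
  prolong acyc {r} {x} {y} {ys} (suc k) n< l@(xy ∷ _) u@(x∉ ∷ _) r∈
    with any? (λ z → (adj G x z Bool.≟ true) ×-dec ¬? (z ≟ y))
  ... | no ¬more = record
    { ℓ = x ; p = y ; ℓ≢r = All.lookup x∉ r∈ ; ℓp = xy ; only-p = only }
    where
    only : ∀ z → Adj G x z → z ≡ y
    only z xz with z ≟ y
    ... | yes e = e
    ... | no ne = ⊥-elim (¬more (z , xz , ne))
  ... | yes (z , xz , z≢y) with mem? _≟_ z ys
  ...   | yes z∈ = ⊥-elim (acyc (close-cycle l u z∈ zx))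
    where zx = trans (adj-sym G z x) xz
  ...   | no z∉ = prolong acyc k (subst (n <_) (sym (+-suc k _)) n<) (trans (adj-sym G z x) xz ∷ l)
          (All.tabulate fresh ∷ u) (there r∈)
    where
    fresh : ∀ {v} → v ∈ x ∷ y ∷ ys → ¬ (z ≡ v)
    fresh (here refl)          refl = true≢false xz (irrefl G x)
    fresh (there (here refl))  e    = z≢y e
    fresh (there (there v∈))   refl = z∉ v∈

-- Starts from an edge at `r`. As `r` stays in the tail while the path grows at its other end, the
-- leaf reached is not `r`.
leaf-off-root : ∀ {n} (G : SimpleGraph (suc (suc n))) → Connected G → Acyclic G → ∀ r → LeafOffRoot G r
leaf-off-root {n} G conn acyc r = start (other r) (other-≢ r) (conn r (other r))
  where
  other : Fin (suc (suc n)) → Fin (suc (suc n))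
  other zero    = suc zero
  other (suc _) = zero
  other-≢ : ∀ r → ¬ (r ≡ other r)
  other-≢ zero    ()
  other-≢ (suc _) ()
  start : ∀ v → ¬ (r ≡ v) → Reachable G r v → LeafOffRoot G r
  start v r≢v here = ⊥-elim (r≢v refl)
  start v r≢v (step {v = y} ry _) = prolong G acyc (suc (suc n)) (m<m+n (suc (suc n)) (s≤s z≤n))
    (trans (adj-sym G y r) ry ∷ [-])
    (((λ { refl → true≢false ry (irrefl G r) }) All.∷ All.[]) ∷ (All.[] ∷ [])) (here refl)

-- Removing a leaf

removeVertex : ∀ {n} → SimpleGraph (suc n) → Fin (suc n) → SimpleGraph n
removeVertex G ℓ = record
  { adj    = λ i j → adj G (punchIn ℓ i) (punchIn ℓ j)
  ; sym    = λ i j → adj-sym G (punchIn ℓ i) (punchIn ℓ j)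
  ; irrefl = λ i → irrefl G (punchIn ℓ i)
  }

removeVertex-acyclic : ∀ {n} {G : SimpleGraph (suc n)} ℓ → Acyclic G → Acyclic (removeVertex G ℓ)
removeVertex-acyclic ℓ acyc K = acyc (record
  { m = m ; c = punchIn ℓ ∘ c ; inj = inj ∘ punchIn-injective ℓ _ _ ; cons = cons ; close = close })
  where open Cycle K

module _ {n} {G : SimpleGraph (suc n)} {ℓ p : Fin (suc n)} (only-p : ∀ z → Adj G ℓ z → z ≡ p) where

  -- A walk enters and leaves the leaf ℓ through the same neighbour.
  bypass : ∀ {u v} → Reachable G u v → ∀ i j → u ≡ punchIn ℓ i → v ≡ punchIn ℓ j → Reachable (removeVertex G ℓ) i j
  bypass here i j refl e with refl ← punchIn-injective ℓ i j e = here
  bypass (step {u} {w} uw walk) i j refl e with ℓ ≟ w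
  ... | no ℓ≢w = step (trans (cong (adj G (punchIn ℓ i)) (punchIn-punchOut ℓ≢w)) uw)
                      (bypass walk (punchOut ℓ≢w) j (sym (punchIn-punchOut ℓ≢w)) e)
  bypass (step uw here) i j refl e | yes refl = ⊥-elim (punchInᵢ≢i ℓ j (sym e))
  bypass (step uw (step ℓw walk)) i j refl e | yes refl =
    bypass walk i j (trans (only-p _ ℓw) (sym (only-p _ (trans (adj-sym G ℓ _) uw)))) e

  removeLeaf-connected : Connected G → Connected (removeVertex G ℓ)
  removeLeaf-connected conn i j = bypass (conn (punchIn ℓ i) (punchIn ℓ j)) i j refl refl

-- Adding a leaf

addLeaf : ∀ t → Vertex t → Tree
addLeaf •       _        = • ◁ •
addLeaf (t ◁ s) (inj₁ x) = addLeaf t x ◁ s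
addLeaf (t ◁ s) (inj₂ y) = t ◁ addLeaf s y

size-addLeaf : ∀ t x → size (addLeaf t x) ≡ suc (size t)
size-addLeaf •       _        = refl
size-addLeaf (t ◁ s) (inj₁ x) = cong (_+ size s) (size-addLeaf t x)
size-addLeaf (t ◁ s) (inj₂ y) = trans (cong (size t +_) (size-addLeaf s y)) (+-suc (size t) (size s))

-- `nothing` stands for the new leaf, `just` for the old vertices.
embed : ∀ t x → Maybe (Vertex t) → Vertex (addLeaf t x)
embed •       _        (just _)        = inj₁ tt
embed •       _        nothing         = inj₂ tt
embed (t ◁ s) (inj₁ x) (just (inj₁ v)) = inj₁ (embed t x (just v))
embed (t ◁ s) (inj₁ x) (just (inj₂ v)) = inj₂ v
embed (t ◁ s) (inj₁ x) nothing         = inj₁ (embed t x nothing)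
embed (t ◁ s) (inj₂ y) (just (inj₁ v)) = inj₁ v
embed (t ◁ s) (inj₂ y) (just (inj₂ v)) = inj₂ (embed s y (just v))
embed (t ◁ s) (inj₂ y) nothing         = inj₂ (embed s y nothing)

unembed : ∀ t x → Vertex (addLeaf t x) → Maybe (Vertex t)
unembed •       _        (inj₁ _) = just tt
unembed •       _        (inj₂ _) = nothing
unembed (t ◁ s) (inj₁ x) (inj₁ v) = Maybe.map inj₁ (unembed t x v)
unembed (t ◁ s) (inj₁ x) (inj₂ v) = just (inj₂ v)
unembed (t ◁ s) (inj₂ y) (inj₁ v) = just (inj₁ v)
unembed (t ◁ s) (inj₂ y) (inj₂ v) = Maybe.map inj₂ (unembed s y v)

unembed-embed : ∀ t x m → unembed t x (embed t x m) ≡ m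
unembed-embed •       _        (just tt)       = refl
unembed-embed •       _        nothing         = refl
unembed-embed (t ◁ s) (inj₁ x) (just (inj₁ v)) = cong (Maybe.map inj₁) (unembed-embed t x (just v))
unembed-embed (t ◁ s) (inj₁ x) (just (inj₂ v)) = refl
unembed-embed (t ◁ s) (inj₁ x) nothing         = cong (Maybe.map inj₁) (unembed-embed t x nothing)
unembed-embed (t ◁ s) (inj₂ y) (just (inj₁ v)) = refl
unembed-embed (t ◁ s) (inj₂ y) (just (inj₂ v)) = cong (Maybe.map inj₂) (unembed-embed s y (just v))
unembed-embed (t ◁ s) (inj₂ y) nothing         = cong (Maybe.map inj₂) (unembed-embed s y nothing)

embed-unembed : ∀ t x v → embed t x (unembed t x v) ≡ v
embed-unembed •       _        (inj₁ tt) = refl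
embed-unembed •       _        (inj₂ tt) = refl
embed-unembed (t ◁ s) (inj₁ x) (inj₁ v) with unembed t x v | embed-unembed t x v
... | just _  | e = cong inj₁ e
... | nothing | e = cong inj₁ e
embed-unembed (t ◁ s) (inj₁ x) (inj₂ v) = refl
embed-unembed (t ◁ s) (inj₂ y) (inj₁ v) = refl
embed-unembed (t ◁ s) (inj₂ y) (inj₂ v) with unembed s y v | embed-unembed s y v
... | just _  | e = cong inj₂ e
... | nothing | e = cong inj₂ e

embed-root : ∀ t x → embed t x (just (root t)) ≡ root (addLeaf t x)
embed-root •       _        = refl
embed-root (t ◁ s) (inj₁ x) = cong inj₁ (embed-root t x)
embed-root (t ◁ s) (inj₂ y) = refl

isRoot-embed : ∀ t x v → isRoot (addLeaf t x) (embed t x (just v)) ≡ isRoot t v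
isRoot-embed •       _        _        = refl
isRoot-embed (t ◁ s) (inj₁ x) (inj₁ v) = isRoot-embed t x v
isRoot-embed (t ◁ s) (inj₁ x) (inj₂ v) = refl
isRoot-embed (t ◁ s) (inj₂ y) (inj₁ v) = refl
isRoot-embed (t ◁ s) (inj₂ y) (inj₂ v) = refl

isRoot-new : ∀ t x → isRoot (addLeaf t x) (embed t x nothing) ≡ false
isRoot-new •       _        = refl
isRoot-new (t ◁ s) (inj₁ x) = isRoot-new t x
isRoot-new (t ◁ s) (inj₂ y) = refl

adjᵗ-embed : ∀ t x v w → adjᵗ (addLeaf t x) (embed t x (just v)) (embed t x (just w)) ≡ adjᵗ t v w
adjᵗ-embed •       _        _        _        = refl
adjᵗ-embed (t ◁ s) (inj₁ x) (inj₁ v) (inj₁ w) = adjᵗ-embed t x v w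
adjᵗ-embed (t ◁ s) (inj₁ x) (inj₁ v) (inj₂ w) = cong (_∧ isRoot s w) (isRoot-embed t x v)
adjᵗ-embed (t ◁ s) (inj₁ x) (inj₂ v) (inj₁ w) = cong (_∧ isRoot s v) (isRoot-embed t x w)
adjᵗ-embed (t ◁ s) (inj₁ x) (inj₂ v) (inj₂ w) = refl
adjᵗ-embed (t ◁ s) (inj₂ y) (inj₁ v) (inj₁ w) = refl
adjᵗ-embed (t ◁ s) (inj₂ y) (inj₁ v) (inj₂ w) = cong (isRoot t v ∧_) (isRoot-embed s y w)
adjᵗ-embed (t ◁ s) (inj₂ y) (inj₂ v) (inj₁ w) = cong (isRoot t w ∧_) (isRoot-embed s y v)
adjᵗ-embed (t ◁ s) (inj₂ y) (inj₂ v) (inj₂ w) = adjᵗ-embed s y v w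

adjᵗ-new : ∀ t x → adjᵗ (addLeaf t x) (embed t x nothing) (embed t x (just x)) ≡ true
adjᵗ-new •       _        = refl
adjᵗ-new (t ◁ s) (inj₁ x) = adjᵗ-new t x
adjᵗ-new (t ◁ s) (inj₂ y) = adjᵗ-new s y

adjᵗ-new-only : ∀ t x v → adjᵗ (addLeaf t x) (embed t x nothing) (embed t x (just v)) ≡ true → v ≡ x
adjᵗ-new-only •       _        _        e = refl
adjᵗ-new-only (t ◁ s) (inj₁ x) (inj₁ v) e = cong inj₁ (adjᵗ-new-only t x v e)
adjᵗ-new-only (t ◁ s) (inj₁ x) (inj₂ v) e = ⊥-elim (true≢false (proj₁ (∧-true e)) (isRoot-new t x))
adjᵗ-new-only (t ◁ s) (inj₂ y) (inj₁ v) e = ⊥-elim (true≢false (proj₂ (∧-true {isRoot t v} e)) (isRoot-new s y))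
adjᵗ-new-only (t ◁ s) (inj₂ y) (inj₂ v) e = cong inj₂ (adjᵗ-new-only s y v e)

-- Realizing every tree graph by a rooted tree

bool-ext : ∀ {a b} → (a ≡ true → b ≡ true) → (b ≡ true → a ≡ true) → a ≡ b
bool-ext {false} {false} p q = refl
bool-ext {false} {true}  p q = q refl
bool-ext {true}  {_}     p q = sym (p refl)

-- Together with `pull`, identifies `Fin (suc n)` with `Maybe (Fin n)`, where `nothing` is the
-- removed vertex.
push : ∀ {n} → Fin (suc n) → Maybe (Fin n) → Fin (suc n)
push ℓ nothing  = ℓ
push ℓ (just i) = punchIn ℓ i

pull : ∀ {n} → Fin (suc n) → Fin (suc n) → Maybe (Fin n)
pull ℓ i with ℓ ≟ i
... | yes _  = nothing
... | no ℓ≢i = just (punchOut ℓ≢i)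

push-pull : ∀ {n} (ℓ i : Fin (suc n)) → push ℓ (pull ℓ i) ≡ i
push-pull ℓ i with ℓ ≟ i
... | yes e  = e
... | no ℓ≢i = punchIn-punchOut ℓ≢i

pull-push : ∀ {n} (ℓ : Fin (suc n)) m → pull ℓ (push ℓ m) ≡ m
pull-push ℓ nothing with ℓ ≟ ℓ
... | yes _ = refl
... | no ne = ⊥-elim (ne refl)
pull-push ℓ (just i) with ℓ ≟ punchIn ℓ i
... | yes e = ⊥-elim (punchInᵢ≢i ℓ i (sym e))
... | no ne = cong just (trans (punchOut-cong ℓ refl) (punchOut-punchIn ℓ))

record RootedAt {n} (G : SimpleGraph n) (r : Fin n) : Set where
  field
    tree     : Tree
    size≡    : size tree ≡ n
    realizes : Realizes G tree
    to-root  : Realizes.to realizes r ≡ root tree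

-- Removes a leaf other than `r`, so that the root survives, realizes the rest by induction and adds
-- the leaf back at its neighbour.
rooted : ∀ n (G : SimpleGraph (suc n)) → Connected G → Acyclic G → ∀ r → RootedAt G r
rooted zero G conn acyc zero = record
  { tree = • ; size≡ = refl ; to-root = refl
  ; realizes = record
    { to = λ _ → tt ; from = λ _ → zero ; from∘to = λ { zero → refl } ; to∘from = λ _ → refl
    ; adj≡ = λ { zero zero → irrefl G zero } } }
rooted (suc n) G conn acyc r = record
  { tree = addLeaf t x
  ; size≡ = trans (size-addLeaf t x) (cong suc IH.size≡)
  ; to-root = trans (cong (embed t x ∘ Maybe.map to) pull-r)
      (trans (cong (embed t x ∘ just) IH.to-root) (embed-root t x))
  ; realizes = record
    { to      = embed t x ∘ Maybe.map to ∘ pull ℓ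
    ; from    = push ℓ ∘ Maybe.map from ∘ unembed t x
    ; from∘to = λ i → trans (cong (push ℓ ∘ Maybe.map from) (unembed-embed t x _))
        (trans (cong (push ℓ) (from∘to? (pull ℓ i))) (push-pull ℓ i))
    ; to∘from = λ v → trans (cong (embed t x ∘ Maybe.map to) (pull-push ℓ (Maybe.map from (unembed t x v))))
        (trans (cong (embed t x) (to∘from? (unembed t x v))) (embed-unembed t x v))
    ; adj≡    = λ i j → trans (sym (cong₂ (adj G) (push-pull ℓ i) (push-pull ℓ j))) (adj-push (pull ℓ i) (pull ℓ j))
    }
  }
  where
  open LeafOffRoot (leaf-off-root G conn acyc r)
  G′ = removeVertex G ℓ
  module IH = RootedAt (rooted n G′ (removeLeaf-connected only-p conn)
    (removeVertex-acyclic {G = G} ℓ acyc) (punchOut ℓ≢r))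
  t = IH.tree
  open Realizes IH.realizes
  ℓ≢p : ¬ (ℓ ≡ p)
  ℓ≢p e = true≢false (subst (Adj G ℓ) (sym e) ℓp) (irrefl G ℓ)
  x = to (punchOut ℓ≢p)
  pull-r : pull ℓ r ≡ just (punchOut ℓ≢r)
  pull-r = trans (cong (pull ℓ) (sym (punchIn-punchOut ℓ≢r))) (pull-push ℓ (just (punchOut ℓ≢r)))
  from∘to? : ∀ m → Maybe.map from (Maybe.map to m) ≡ m
  from∘to? (just i) = cong just (from∘to i)
  from∘to? nothing  = refl
  to∘from? : ∀ m → Maybe.map to (Maybe.map from m) ≡ m
  to∘from? (just v) = cong just (to∘from v)
  to∘from? nothing  = refl
  adj-leaf : ∀ i → adj G ℓ (punchIn ℓ i) ≡ adjᵗ (addLeaf t x) (embed t x nothing) (embed t x (just (to i)))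
  adj-leaf i = bool-ext
    (λ e → subst (λ k → adjᵗ (addLeaf t x) (embed t x nothing) (embed t x (just (to k))) ≡ true)
      (punchIn-injective ℓ _ _ (trans (punchIn-punchOut ℓ≢p) (sym (only-p _ e)))) (adjᵗ-new t x))
    (λ e → subst (Adj G ℓ) (trans (sym (punchIn-punchOut ℓ≢p))
      (cong (punchIn ℓ) (sym (to-injective IH.realizes (adjᵗ-new-only t x (to i) e))))) ℓp)
  adj-push : ∀ a b → adj G (push ℓ a) (push ℓ b)
    ≡ adjᵗ (addLeaf t x) (embed t x (Maybe.map to a)) (embed t x (Maybe.map to b))
  adj-push nothing  nothing  = trans (irrefl G ℓ) (sym (adjᵗ-irrefl (addLeaf t x) _))
  adj-push nothing  (just j) = adj-leaf j
  adj-push (just i) nothing  = trans (adj-sym G _ _) (trans (adj-leaf i) (adjᵗ-sym (addLeaf t x) _ _))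
  adj-push (just i) (just j) = trans (adj≡ i j) (sym (adjᵗ-embed t x (to i) (to j)))

treeGraph : ∀ t → Graph (Vertex t)
treeGraph t = record { Edge = λ x y → adjᵗ t x y ≡ true }

≅-trans : ∀ {U V W} {G : Graph U} {H : Graph V} {K : Graph W} → G ≅ H → H ≅ K → G ≅ K
≅-trans p q = record
  { to      = Q.to ∘ P.to
  ; from    = P.from ∘ Q.from
  ; from∘to = λ x → trans (cong P.from (Q.from∘to (P.to x))) (P.from∘to x)
  ; to∘from = λ y → trans (cong Q.to (P.to∘from (Q.from y))) (Q.to∘from y)
  ; edge⇔   = λ x y → Comp.equivalence (P.edge⇔ x y) (Q.edge⇔ (P.to x) (P.to y))
  }
  where
  module P = _≅_ p
  module Q = _≅_ q

≅-injective : ∀ {V W} {G : Graph V} {H : Graph W} (p : G ≅ H) → ∀ {x y} → _≅_.to p x ≡ _≅_.to p y → x ≡ y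
≅-injective p {x} {y} e = trans (sym (from∘to x)) (trans (cong from e) (from∘to y))
  where open _≅_ p

≅-leaf : ∀ {V W} {G : Graph V} {H : Graph W} (p : G ≅ H) {x} → IsLeaf G x → IsLeaf H (_≅_.to p x)
≅-leaf {H = H} p {x} leafx y z xy xz = trans (sym (to∘from y)) (trans (cong to
  (leafx (from y) (from z) (pull-edge xy) (pull-edge xz))) (to∘from z))
  where
  open _≅_ p
  pull-edge : ∀ {y} → Edge H (to x) y → _
  pull-edge {y} e = Equivalence.from (edge⇔ x (from y)) (subst (Edge H (to x)) (sym (to∘from y)) e)

realizes-≅ : ∀ {n} {G : SimpleGraph n} {t} → Realizes G t → toGraph G ≅ treeGraph t
realizes-≅ R = record
  { to = to ; from = from ; from∘to = from∘to ; to∘from = to∘from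
  ; edge⇔ = λ x y → mk⇔ (trans (sym (adj≡ x y))) (trans (adj≡ x y)) }
  where open Realizes R

-- Trees of stars

-- Since the root is a leaf, such a tree can be attached by its root to a new centre.
record StarTree (z : Tree) : Set₁ where
  field
    {V}   : Set
    H     : Graph V
    stars : IsTreeOfStars H
    iso   : treeGraph z ≅ H
    leafʳ : IsLeaf H (_≅_.to iso (root z))

-- A centre with `k` arms. Unlike `join` it admits k = 0 and k = 1, so a centre can be built one arm
-- at a time.
record Joined (k : ℕ) (t : Tree) : Set₁ where
  field
    {V}      : Fin k → Set
    H        : ∀ i → Graph (V i)
    stars    : ∀ i → IsTreeOfStars (H i)
    v        : ∀ i → V i
    leaves   : ∀ i → IsLeaf (H i) (v i)
    iso      : treeGraph t ≅ joinGraph H v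
    to-root  : _≅_.to iso (root t) ≡ nothing

joined-• : Joined 0 •
joined-• = record
  { V = λ () ; H = λ () ; stars = λ () ; v = λ () ; leaves = λ ()
  ; iso = record
    { to = λ _ → nothing ; from = λ _ → tt ; from∘to = λ _ → refl
    ; to∘from = λ { nothing → refl }
    ; edge⇔ = λ _ _ → mk⇔ (λ ()) (λ ()) }
  ; to-root = refl }

module _ {k t z} (J : Joined k t) (S : StarTree z) where
  private
    module J = Joined J
    module S = StarTree S
    module Jᵢ = _≅_ J.iso
    module Sᵢ = _≅_ S.iso

    V′ : Fin (suc k) → Set
    V′ zero    = S.V
    V′ (suc i) = J.V i

    H′ : ∀ i → Graph (V′ i)
    H′ = ∀-cons S.H J.H

    v′ : ∀ i → V′ i
    v′ = ∀-cons (Sᵢ.to (root z)) J.v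

    lift : Maybe (Σ (Fin k) J.V) → Maybe (Σ (Fin (suc k)) V′)
    lift nothing        = nothing
    lift (just (i , x)) = just (suc i , x)

    lift⁺ : ∀ {a b} → JoinEdge J.H J.v a b → JoinEdge H′ v′ (lift a) (lift b)
    lift⁺ (w→v i)      = w→v (suc i)
    lift⁺ (v→w i)      = v→w (suc i)
    lift⁺ (inside i e) = inside (suc i) e

    lift⁻ : ∀ a b → JoinEdge H′ v′ (lift a) (lift b) → JoinEdge J.H J.v a b
    lift⁻ nothing        (just (i , _)) (w→v _)      = w→v i
    lift⁻ (just (i , _)) nothing        (v→w _)      = v→w i
    lift⁻ (just (i , _)) (just (_ , _)) (inside _ e) = inside i e

    to′ : Vertex (t ◁ z) → Maybe (Σ (Fin (suc k)) V′)
    to′ (inj₁ x) = lift (Jᵢ.to x)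
    to′ (inj₂ y) = just (zero , Sᵢ.to y)

    from′ : Maybe (Σ (Fin (suc k)) V′) → Vertex (t ◁ z)
    from′ nothing            = inj₁ (Jᵢ.from nothing)
    from′ (just (zero , y))  = inj₂ (Sᵢ.from y)
    from′ (just (suc i , x)) = inj₁ (Jᵢ.from (just (i , x)))

    from′-lift : ∀ a → from′ (lift a) ≡ inj₁ (Jᵢ.from a)
    from′-lift nothing  = refl
    from′-lift (just _) = refl

    from∘to′ : ∀ x → from′ (to′ x) ≡ x
    from∘to′ (inj₁ x) = trans (from′-lift (Jᵢ.to x)) (cong inj₁ (Jᵢ.from∘to x))
    from∘to′ (inj₂ y) = cong inj₂ (Sᵢ.from∘to y)

    to∘from′ : ∀ y → to′ (from′ y) ≡ y
    to∘from′ nothing            = cong lift (Jᵢ.to∘from nothing)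
    to∘from′ (just (zero , y))  = cong (λ w → just (zero , w)) (Sᵢ.to∘from y)
    to∘from′ (just (suc i , x)) = cong lift (Jᵢ.to∘from (just (i , x)))

    bridge⁺ : ∀ x y → isRoot t x ∧ isRoot z y ≡ true → Jᵢ.to x ≡ nothing × Sᵢ.to y ≡ v′ zero
    bridge⁺ x y e with refl , refl ← cross-roots t z x y e = J.to-root , refl

    bridge⁻ : ∀ x y → Jᵢ.to x ≡ nothing → Sᵢ.to y ≡ v′ zero → isRoot t x ∧ isRoot z y ≡ true
    bridge⁻ x y ex ey with refl ← ≅-injective J.iso (trans ex (sym J.to-root)) | refl ← ≅-injective S.iso ey =
      cong₂ _∧_ (isRoot-root t) (isRoot-root z)

    down⁻ : ∀ a {b} → JoinEdge H′ v′ (lift a) (just (zero , b)) → a ≡ nothing × b ≡ v′ zero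
    down⁻ nothing (w→v _) = refl , refl

    up⁻ : ∀ a {b} → JoinEdge H′ v′ (just (zero , b)) (lift a) → a ≡ nothing × b ≡ v′ zero
    up⁻ nothing (v→w _) = refl , refl

    inner⁻ : ∀ {a b} → JoinEdge H′ v′ (just (zero , a)) (just (zero , b)) → Edge S.H a b
    inner⁻ (inside _ e) = e

    edge⇔′ : ∀ x y → adjᵗ (t ◁ z) x y ≡ true ⇔ JoinEdge H′ v′ (to′ x) (to′ y)
    edge⇔′ (inj₁ x) (inj₁ y) = mk⇔ (lift⁺ ∘ Equivalence.to (Jᵢ.edge⇔ x y))
      (Equivalence.from (Jᵢ.edge⇔ x y) ∘ lift⁻ _ _)
    edge⇔′ (inj₂ x) (inj₂ y) = mk⇔ (inside zero ∘ Equivalence.to (Sᵢ.edge⇔ x y))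
      (Equivalence.from (Sᵢ.edge⇔ x y) ∘ inner⁻)
    edge⇔′ (inj₁ x) (inj₂ y) = mk⇔
      (λ e → subst₂ (λ a b → JoinEdge H′ v′ (lift a) (just (zero , b)))
        (sym (proj₁ (bridge⁺ x y e))) (sym (proj₂ (bridge⁺ x y e))) (w→v zero))
      (λ e → bridge⁻ x y (proj₁ (down⁻ _ e)) (proj₂ (down⁻ _ e)))
    edge⇔′ (inj₂ y) (inj₁ x) = mk⇔
      (λ e → subst₂ (λ a b → JoinEdge H′ v′ (just (zero , b)) (lift a))
        (sym (proj₁ (bridge⁺ x y e))) (sym (proj₂ (bridge⁺ x y e))) (v→w zero))
      (λ e → bridge⁻ x y (proj₁ (up⁻ _ e)) (proj₂ (up⁻ _ e)))

  joined-◁ : Joined (suc k) (t ◁ z)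
  joined-◁ = record
    { V = V′ ; H = H′ ; v = v′
    ; stars = ∀-cons S.stars J.stars
    ; leaves = ∀-cons S.leafʳ J.leaves
    ; iso = record { to = to′ ; from = from′ ; from∘to = from∘to′ ; to∘from = to∘from′ ; edge⇔ = edge⇔′ }
    ; to-root = cong lift J.to-root
    }

◁•-swap-≅ : ∀ a → treeGraph (• ◁ a) ≅ treeGraph (a ◁ •)
◁•-swap-≅ a = record
  { to = swap ; from = swap′
  ; from∘to = λ { (inj₁ _) → refl ; (inj₂ _) → refl }
  ; to∘from = λ { (inj₁ _) → refl ; (inj₂ _) → refl }
  ; edge⇔ = λ
    { (inj₁ _) (inj₁ _) → mk⇔ (λ e → e) (λ e → e)
    ; (inj₂ _) (inj₂ _) → mk⇔ (λ e → e) (λ e → e)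
    ; (inj₁ _) (inj₂ y) → mk⇔ (λ e → cong (_∧ true) e) (proj₁ ∘ ∧-true)
    ; (inj₂ x) (inj₁ _) → mk⇔ (λ e → cong (_∧ true) e) (proj₁ ∘ ∧-true) } }
  where
  swap : Vertex (• ◁ a) → Vertex (a ◁ •)
  swap (inj₁ x) = inj₂ x
  swap (inj₂ y) = inj₁ y
  swap′ : Vertex (a ◁ •) → Vertex (• ◁ a)
  swap′ (inj₁ x) = inj₂ x
  swap′ (inj₂ y) = inj₁ y

starTree-• : StarTree •
starTree-• = record
  { H = singleGraph ; stars = single ; leafʳ = λ _ _ ()
  ; iso = record
    { to = λ x → x ; from = λ x → x ; from∘to = λ _ → refl ; to∘from = λ _ → refl
    ; edge⇔ = λ _ _ → mk⇔ (λ ()) (λ ()) } }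

-- The index `suc k` records at least one arm; one added leaf then gives the two that `join`
-- requires.
A-joined   : ∀ {a} → IsA a → ∃[ k ] Joined (suc k) a
Hub-joined : ∀ {q} → Hub q → ∃[ k ] Joined k q
B-starTree : ∀ {z} → IsB z → StarTree z
A-joined (node h zB) = _ , joined-◁ (proj₂ (Hub-joined h)) (B-starTree zB)
Hub-joined bare      = 0 , joined-•
Hub-joined (arms qA) = _ , proj₂ (A-joined qA)
B-starTree leaf          = starTree-•
-- The root • is one more leaf of the star centred at the root of a.
B-starTree (stem {a} aA) = record
  { H = joinGraph J.H J.v
  ; stars = join (s≤s (s≤s z≤n)) J.H J.stars J.v J.leaves
  ; iso = iso
  ; leafʳ = ≅-leaf iso {root (• ◁ a)} λ
      { (inj₂ x) (inj₂ y) ex ey → cong inj₂ (trans (isRoot⇒≡ a x ex) (sym (isRoot⇒≡ a y ey))) }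
  }
  where
  module J = Joined (joined-◁ (proj₂ (A-joined aA)) starTree-•)
  iso = ≅-trans (◁•-swap-≅ a) J.iso

-- Paths

data Line : Tree → Set where
  point  : Line •
  append : ∀ {t} → Line t → Line (• ◁ t)

oddPath-line : ∀ {z} → OddPathTree z → Line z
oddPath-line single     = point
oddPath-line (extend p) = append (append (oddPath-line p))

oddPath-size : ∀ {z} → OddPathTree z → ∃[ k ] size z ≡ suc (2 * k)
oddPath-size single = 0 , refl
oddPath-size (extend p) with oddPath-size p
... | k , e = suc k , trans (cong (λ w → suc (suc w)) e) (cong suc (sym (*-suc 2 k)))

-- The position of the root is carried through the induction because the next vertex is attached
-- there.
line-≅ : ∀ {t} → Line t → Σ[ p ∈ treeGraph t ≅ pathGraph (size t) ] toℕ (_≅_.to p (root t)) ≡ 0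
line-≅ point = record
  { to = λ _ → zero ; from = λ _ → tt ; from∘to = λ _ → refl ; to∘from = λ { zero → refl }
  ; edge⇔ = λ _ _ → mk⇔ (λ ()) λ { (inj₁ ()) ; (inj₂ ()) } } , refl
line-≅ (append {t} l) with line-≅ l
... | p , e₀ = record { to = to′ ; from = from′ ; from∘to = from∘to′ ; to∘from = to∘from′ ; edge⇔ = edge⇔′ } , refl
  where
  open _≅_ p
  to′ : Vertex (• ◁ t) → Fin (suc (size t))
  to′ (inj₁ _) = zero
  to′ (inj₂ y) = suc (to y)
  from′ : Fin (suc (size t)) → Vertex (• ◁ t)
  from′ zero    = inj₁ tt
  from′ (suc i) = inj₂ (from i)
  from∘to′ : ∀ x → from′ (to′ x) ≡ x
  from∘to′ (inj₁ tt) = refl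
  from∘to′ (inj₂ y)  = cong inj₂ (from∘to y)
  to∘from′ : ∀ i → to′ (from′ i) ≡ i
  to∘from′ zero    = refl
  to∘from′ (suc i) = cong suc (to∘from i)
  at-zero : ∀ y → toℕ (to y) ≡ 0 → isRoot t y ≡ true
  at-zero y e with refl ← ≅-injective p {y} {root t} (toℕ-injective (trans e (sym e₀))) = isRoot-root t
  root-zero : ∀ y → isRoot t y ≡ true → suc (toℕ (to y)) ≡ 1
  root-zero y e with refl ← isRoot⇒≡ t y e = cong suc e₀
  edge⇔′ : ∀ x y → adjᵗ (• ◁ t) x y ≡ true ⇔ Edge (pathGraph (suc (size t))) (to′ x) (to′ y)
  edge⇔′ (inj₁ _) (inj₁ _) = mk⇔ (λ ()) λ { (inj₁ ()) ; (inj₂ ()) }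
  edge⇔′ (inj₁ _) (inj₂ y) = mk⇔ (inj₁ ∘ root-zero y) λ { (inj₁ e) → at-zero y (suc-injective e) ; (inj₂ ()) }
  edge⇔′ (inj₂ x) (inj₁ _) = mk⇔ (inj₂ ∘ root-zero x) λ { (inj₁ ()) ; (inj₂ e) → at-zero x (suc-injective e) }
  edge⇔′ (inj₂ x) (inj₂ y) = mk⇔
    (Sum.map (cong suc) (cong suc) ∘ Equivalence.to (edge⇔ x y))
    (Equivalence.from (edge⇔ x y) ∘ Sum.map suc-injective suc-injective)

-- Rooting an extremal tree at a leaf

find-leaf : ∀ n (G : SimpleGraph (suc n)) → Connected G → Acyclic G → ∃[ r ] IsLeaf (toGraph G) r
find-leaf zero    G conn acyc = zero , λ { zero zero _ _ → refl }
find-leaf (suc n) G conn acyc = ℓ , λ x y ex ey → trans (only-p x ex) (sym (only-p y ey))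
  where open LeafOffRoot (leaf-off-root G conn acyc zero)

conclude : ∀ {n} {G : SimpleGraph n} → Extremal G → ∀ {t} → Realizes G t → size t ≡ n →
  IsLeaf (treeGraph t) (root t) → TreeOfStars G ⊎ OddPath G
conclude ext {•} R refl _ = inj₁ (⊤ , singleGraph , single , ≅-trans (realizes-≅ R) (StarTree.iso starTree-•))
conclude ext {t ◁ s ◁ c} R refl rootLeaf
  with () ← rootLeaf (inj₂ (root c)) (inj₁ (inj₂ (root s)))
    (cong₂ _∧_ (isRoot-root t) (isRoot-root c)) (cong₂ _∧_ (isRoot-root t) (isRoot-root s))
conclude ext {• ◁ c} R refl _ with leaf-rooted c
... | inj₁ B = inj₁ (_ , H , stars , ≅-trans (realizes-≅ R) iso)
  where open StarTree (B-starTree B)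
-- The root leaf adds one vertex, so the number of edges is the size of `c`.
... | inj₂ (inj₁ odd) = inj₂ (≅-trans (realizes-≅ R) (proj₁ (line-≅ (append (oddPath-line odd)))) , oddPath-size odd)
... | inj₂ (inj₂ (better u size≡ α≡ f<)) = ⊥-elim (<⇒≱ f< (extremal-minimal R ext u size≡ α≡))

theorem1 : ∀ (n : ℕ) (T : SimpleGraph n) → Extremal T → TreeOfStars T ⊎ OddPath T
theorem1 zero    T ((() , _) , _)
theorem1 (suc n) T ext@((_ , conn , acyc) , _) with find-leaf n T conn acyc
... | r , rLeaf = conclude ext realizes size≡
        (subst (IsLeaf (treeGraph tree)) to-root (≅-leaf (realizes-≅ realizes) rLeaf))
  where open RootedAt (rooted n T conn acyc r)
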